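{- For every integer $n \geq 7$, $$ \begin{cases} 3n-3\leq R(W_{n},W_{n})\leq 8n-10, & \text{ if $n$ is even;}\\ 2n-2\leq R(W_{n},W_{n})\leq 6n-8, & \text{ if $n$ is odd.} \end{cases} $$
   Context: For $n \geq 4$, the wheel $W_n$ is the graph of order $n$ given by $W_n = K_1 \vee C_{n-1}$, i.e., a cycle on $n-1$ vertices together with one additional vertex adjacent to all vertices of the cycle. For graphs $G,H$, the Ramsey number $R(G,H)$ is the minimum integer $N$ such that every coloring of the edges of $K_N$ with colors red and blue contains a red copy of $G$ or a blue copy of $H$. -}

module Defs where

open import Data.Nat using (ℕ; zero; suc; _≤_)
open import Data.Fin using (Fin; toℕ) renaming (zero to fz; suc to fs)
open import Data.Bool using (Bool; true; false)
open import Data.Product using (Σ; _×_)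
open import Data.Sum using (_⊎_)
open import Data.Unit using (⊤)
open import Data.Empty using (⊥)
open import Relation.Binary.PropositionalEquality using (_≡_)
open import Function.Definitions using (Injective)

record Graph : Set₁ where
  field
    order : ℕ
    Adj   : Fin order → Fin order → Set
open Graph public

CycAdj : (m : ℕ) → Fin m → Fin m → Set
CycAdj m i j =
  (toℕ j ≡ suc (toℕ i)) ⊎ (toℕ i ≡ suc (toℕ j))
  ⊎ ((toℕ i ≡ 0 × suc (toℕ j) ≡ m) ⊎ (toℕ j ≡ 0 × suc (toℕ i) ≡ m))

WheelAdj : (m : ℕ) → Fin (suc m) → Fin (suc m) → Set
WheelAdj m fz     fz     = ⊥
WheelAdj m fz     (fs j) = ⊤
WheelAdj m (fs i) fz     = ⊤
WheelAdj m (fs i) (fs j) = CycAdj m i j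

-- W_n : the wheel of order n (= K_1 ∨ C_{n-1}); meaningful for n ≥ 4.
Wheel : ℕ → Graph
Wheel zero    = record { order = zero ; Adj = λ _ _ → ⊥ }
Wheel (suc m) = record { order = suc m ; Adj = WheelAdj m }

-- Two-colourings of the edges of K_N: true = red, false = blue
-- (the value on the diagonal is irrelevant).
Colouring : ℕ → Set
Colouring N = Fin N → Fin N → Bool

SymmetricColouring : {N : ℕ} → Colouring N → Set
SymmetricColouring {N} c = (i j : Fin N) → c i j ≡ c j i

MonoCopy : (G : Graph) {N : ℕ} → Colouring N → Bool → Set
MonoCopy G {N} c col =
  Σ (Fin (order G) → Fin N) λ f →
    Injective _≡_ _≡_ f × ((u v : Fin (order G)) → Adj G u v → c (f u) (f v) ≡ col)

Arrows : ℕ → Graph → Graph → Set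
Arrows N G H = (c : Colouring N) → SymmetricColouring c →
  MonoCopy G c true ⊎ MonoCopy H c false

IsRamseyNumber : Graph → Graph → ℕ → Set
IsRamseyNumber G H N = Arrows N G H × ((M : ℕ) → Arrows M G H → N ≤ M)

{-# OPTIONS --safe #-}
-- Write m = n - 1 for the length of the rim and R = R(C_m, C_m). If v has at least 2R + 1 neighbours
-- of one colour, say red, and one of them, u, has R blue neighbours among them, then a monochromatic
-- C_m inside these R vertices has v or u as a hub. Otherwise the red degrees inside the neighbourhood
-- of v exceed half its size, and the arguments of Dirac and Bondy give a red C_m. So 4R + 2 vertices
-- suffice, and it remains to show R ≤ 3m/2 - 1 for even m and R ≤ 2m - 1 for odd m.
--
-- For m = 2k, a monochromatic cycle longer than m can be shortened by one or two, so it suffices to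
-- lengthen a longest monochromatic (red) cycle of length c < 2k in K_{3k-1}. For two vertices outside
-- it the number t of crossings (one is red to x_i, the other to x_{i+1}) is at most 2, and 0 if they
-- are joined in red; they have at least (c - t)/2 common blue neighbours on the cycle, and linking the
-- outside vertices through these gives a longer blue cycle.
--
-- For m = 2k - 1, take a red C_{2k}. Without a monochromatic C_m its even and odd vertices form blue
-- cliques, no two disjoint blue edges join the cliques, and every other vertex is completely blue to
-- one of them; one clique together with k - 1 such vertices contains a blue C_m.
--
-- The lower bounds come from three (n even) or two (n odd) red cliques on n - 1 vertices.

module Submission where

open import Defs
import Algebra.Solver.CommutativeMonoid as CMSolver
open import Data.Bool using (Bool; true; false; not)
open import Data.Bool.Properties using (¬-not; not-¬; not-involutive) renaming (_≟_ to _≟ᵇ_)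
open import Data.Empty using (⊥; ⊥-elim)
open import Data.Fin using (Fin; toℕ; inject≤; remQuot; fromℕ<; combine) renaming (zero to fz; suc to fs)
open import Data.Fin.Properties using (any?; all?; toℕ<n; toℕ-injective; toℕ-fromℕ<; combine-remQuot; inject≤-injective) renaming (_≟_ to _≟ᶠ_; pigeonhole to Fin-pigeonhole)
open import Data.List using (List; []; _∷_; [_]; _++_; length; reverse; applyUpTo; allFin)
open import Data.List.Membership.Propositional using (_∈_)
open import Data.List.Membership.Propositional.Properties using (∈-∃++; ∈-++⁺ˡ; ∈-applyUpTo⁺)
open import Data.List.Properties using (length-++; length-applyUpTo; length-reverse; length-tabulate; applyUpTo-∷ʳ; unfold-reverse; ++-assoc) renaming (++-identityʳ to ++-idʳ)
open import Data.List.Relation.Binary.Permutation.Propositional using (_↭_; ↭-refl; ↭-sym; ↭-trans; ↭-reflexive; prep; ↭⇒↭ₛ)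
open import Data.List.Relation.Binary.Permutation.Propositional.Properties using (↭-length; ++⁺; ++⁺ˡ; ++⁺ʳ; shift; ↭-reverse; ++-comm; ++-commutativeMonoid; ++-identityʳ; ∷↭∷ʳ; drop-∷; All-resp-↭; ∈-resp-↭)
open import Data.List.Relation.Binary.Permutation.Setoid.Properties using (AllPairs-resp-↭)
open import Data.List.Relation.Unary.All as All using (All; []; _∷_)
open import Data.List.Relation.Unary.All.Properties using (applyUpTo⁺₁; ++⁻ˡ)
open import Data.List.Relation.Unary.AllPairs as AllPairs using (AllPairs)
import Data.List.Relation.Unary.AllPairs.Properties as AllPairsₚ
open import Data.List.Relation.Unary.Any using (here; there)
open import Data.List.Relation.Unary.Unique.Propositional.Properties using (allFin⁺)
open import Data.Nat using (ℕ; zero; suc; pred; _+_; _*_; _∸_; _%_; _≤_; _<_; z≤n; s≤s; z<s; s<s; s≤s⁻¹; _≤?_; _≟_; >-nonZero)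
open import Data.Nat.DivMod using ([m+kn]%n≡m%n)
open import Data.Nat.Properties hiding (_≟_; _≤?_)
open import Data.Nat.Solver using (module +-*-Solver)
open import Data.Product using (Σ; ∃; _×_; _,_; proj₁; proj₂)
open import Data.Sum using (_⊎_; inj₁; inj₂; [_,_]′)
open import Data.Unit using (tt)
open import Function using (_∘_; id; case_of_)
open import Relation.Binary.Definitions using (tri<; tri≈; tri>)
open import Relation.Binary.PropositionalEquality using (_≡_; _≢_; refl; sym; trans; cong; cong₂; subst; subst₂; setoid)
open import Relation.Nullary using (¬_; Dec; yes; no; contradiction; does)
open import Relation.Nullary.Decidable using (_×-dec_; _⊎-dec_; _→-dec_; ¬?; map′; toWitness; decidable-stable)

module Perm {V : Set} = CMSolver (++-commutativeMonoid {A = V})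
open Perm using (_⊕_; _⊜_) renaming (solve to solve↭)
open +-*-Solver using (con; _:+_; _:*_; _:=_) renaming (solve to solveℕ)

-- Doubling, segments of sequences and lists up to order

dbl : ℕ → ℕ
dbl zero = zero
dbl (suc n) = suc (suc (dbl n))

dbl-+ : ∀ a b → dbl (a + b) ≡ dbl a + dbl b
dbl-+ zero b = refl
dbl-+ (suc a) b = cong (suc ∘ suc) (dbl-+ a b)

dbl≡+ : ∀ a → dbl a ≡ a + a
dbl≡+ zero = refl
dbl≡+ (suc a) = cong suc (trans (cong suc (dbl≡+ a)) (sym (+-suc a a)))

module _ {V : Set} where

  seg : (ℕ → V) → ℕ → List V
  seg = applyUpTo

  seg-+ : ∀ x a b → seg x (a + b) ≡ seg x a ++ seg (x ∘ (a +_)) b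
  seg-+ x zero b = refl
  seg-+ x (suc a) b = cong (x 0 ∷_) (seg-+ (x ∘ suc) a b)

  seg-cong : ∀ {x y : ℕ → V} → (∀ i → x i ≡ y i) → ∀ n → seg x n ≡ seg y n
  seg-cong e zero = refl
  seg-cong e (suc n) = cong₂ _∷_ (e 0) (seg-cong (e ∘ suc) n)

  seg-deal : ∀ (x : ℕ → V) n → seg (x ∘ dbl) n ++ seg (x ∘ suc ∘ dbl) n ↭ seg x (dbl n)
  seg-deal x zero = ↭-refl
  seg-deal x (suc n) = prep (x 0)
      (↭-trans (shift (x 1) (seg (x ∘ suc ∘ suc ∘ dbl) n) _) (prep (x 1) (seg-deal (x ∘ suc ∘ suc) n)))

  -- Sublists up to order. Positions of a list play the role of vertices, so repeated entries do no harm.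
  _⊑_ : List V → List V → Set
  l ⊑ S = ∃ λ r → l ++ r ↭ S

  infix 4 _⊑_

  ⊑-refl : ∀ {l} → l ⊑ l
  ⊑-refl {l} = [] , ++-identityʳ l

  ⊑-trans : ∀ {l m n} → l ⊑ m → m ⊑ n → l ⊑ n
  ⊑-trans {l} (r , p) (s , q) = r ++ s ,
    ↭-trans (solve↭ 3 (λ a b c → (a ⊕ (b ⊕ c)) ⊜ ((a ⊕ b) ⊕ c)) ↭-refl l r s) (↭-trans (++⁺ʳ s p) q)

  ⊑-resp : ∀ {l l' S} → l ↭ l' → l ⊑ S → l' ⊑ S
  ⊑-resp p (r , q) = r , ↭-trans (++⁺ʳ r (↭-sym p)) q

  ⊑-length : ∀ {l m} → l ⊑ m → length l ≤ length m
  ⊑-length {l} (r , p) = subst (length l ≤_) (trans (sym (length-++ l)) (↭-length p)) (m≤m+n _ _)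

  hd : V → List V → V
  hd d [] = d
  hd d (a ∷ _) = a

  rot : List V → List V
  rot [] = []
  rot (a ∷ l) = l ++ [ a ]

  -- The periodic extension of l; the default d is only reached for the empty list.
  stream : V → List V → ℕ → V
  stream d l zero = hd d l
  stream d l (suc i) = stream d (rot l) i

  stream-+ : ∀ d l r i → stream d (l ++ r) (length l + i) ≡ stream d (r ++ l) i
  stream-+ d [] r i = cong (λ q → stream d q i) (sym (++-idʳ r))
  stream-+ d (a ∷ l) r i = trans (cong (λ q → stream d q (length l + i)) (++-assoc l r [ a ]))
    (trans (stream-+ d l (r ++ [ a ]) i) (cong (λ q → stream d q i) (++-assoc r [ a ] l)))

  seg-stream : ∀ d l r → seg (stream d (l ++ r)) (length l) ≡ l
  seg-stream d [] r = refl
  seg-stream d (a ∷ l) r = cong (a ∷_) (trans (cong (λ q → seg (stream d q) (length l)) (++-assoc l r [ a ]))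
    (seg-stream d l (r ++ [ a ])))

  stream-periodic : ∀ d l i → stream d l (length l + i) ≡ stream d l i
  stream-periodic d l i = trans (cong (λ q → stream d q (length l + i)) (sym (++-idʳ l))) (stream-+ d l [] i)

  seg-of-stream : ∀ d l → seg (stream d l) (length l) ≡ l
  seg-of-stream d l = trans (cong (λ q → seg (stream d q) (length l)) (sym (++-idʳ l))) (seg-stream d l [])

  seg-rotate : ∀ (x : ℕ → V) n → x n ≡ x 0 → seg (x ∘ suc) n ↭ seg x n
  seg-rotate x n e = drop-∷
    (↭-trans (↭-reflexive (sym (applyUpTo-∷ʳ x n)))
    (↭-trans (↭-sym (∷↭∷ʳ (x n) (seg x n))) (↭-reflexive (cong (_∷ seg x n) e))))

  Periodic : ℕ → (ℕ → V) → Set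
  Periodic n x = ∀ i → x (n + i) ≡ x i

  seg-shift : ∀ {n x} → Periodic n x → ∀ a → seg (x ∘ (_+ a)) n ↭ seg x n
  seg-shift {n} {x} p zero = ↭-reflexive (seg-cong (λ i → cong x (+-identityʳ i)) n)
  seg-shift {n} {x} p (suc a) = ↭-trans (↭-reflexive (seg-cong (λ i → cong x (+-suc i a)) n))
    (↭-trans (seg-rotate (x ∘ (_+ a)) n (p a)) (seg-shift p a))

-- Counting by sums of indicators

bit : {A : Set} → Dec A → ℕ
bit (yes _) = 1
bit (no _) = 0

bit≤1 : {A : Set} (d : Dec A) → bit d ≤ 1
bit≤1 (yes _) = s≤s z≤n
bit≤1 (no _) = z≤n

bit-yes : {A : Set} (d : Dec A) → A → bit d ≡ 1
bit-yes (yes _) a = refl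
bit-yes (no ¬a) a = ⊥-elim (¬a a)

bit-no : {A : Set} (d : Dec A) → ¬ A → bit d ≡ 0
bit-no (yes a) ¬a = ⊥-elim (¬a a)
bit-no (no _) _ = refl

sumTo : ℕ → (ℕ → ℕ) → ℕ
sumTo zero f = 0
sumTo (suc n) f = f 0 + sumTo n (f ∘ suc)

sumTo-+ : ∀ n f g → sumTo n (λ i → f i + g i) ≡ sumTo n f + sumTo n g
sumTo-+ zero f g = refl
sumTo-+ (suc n) f g = trans (cong (f 0 + g 0 +_) (sumTo-+ n (f ∘ suc) (g ∘ suc)))
  (solveℕ 4 (λ a b c d → (a :+ b) :+ (c :+ d) := (a :+ c) :+ (b :+ d)) refl (f 0) (g 0) _ _)

sumTo-≥ : ∀ n f → (∀ i → i < n → 1 ≤ f i) → n ≤ sumTo n f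
sumTo-≥ zero f p = z≤n
sumTo-≥ (suc n) f p = +-mono-≤ (p 0 z<s) (sumTo-≥ n (f ∘ suc) (λ i → p (suc i) ∘ s<s))

sumTo-none : ∀ {A : ℕ → Set} (A? : ∀ i → Dec (A i)) n → (∀ i → i < n → ¬ A i) → sumTo n (λ i → bit (A? i)) ≡ 0
sumTo-none A? zero p = refl
sumTo-none A? (suc n) p rewrite bit-no (A? 0) (p 0 z<s) = sumTo-none (A? ∘ suc) n (λ i → p (suc i) ∘ s<s)

sumTo-once : ∀ {A : ℕ → Set} (A? : ∀ i → Dec (A i)) n → (∀ i j → i < j → j < n → A i → ¬ A j) →
  sumTo n (λ i → bit (A? i)) ≤ 1
sumTo-once A? zero p = z≤n
sumTo-once A? (suc n) p with A? 0
... | yes a = ≤-reflexive (cong suc (sumTo-none (A? ∘ suc) n (λ i i<n → p 0 (suc i) z<s (s<s i<n) a)))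
... | no _ = sumTo-once (A? ∘ suc) n (λ i j i<j j<n → p (suc i) (suc j) (s<s i<j) (s<s j<n))

-- Parity absorbs the slack of one; the bounds on common neighbours are halved through this.
half : ∀ a C → dbl a ≤ suc (C + C) → a ≤ C
half zero C p = z≤n
half (suc a) zero (s≤s ())
half (suc a) (suc C) (s≤s (s≤s p)) = s≤s (half a C (≤-trans p (≤-reflexive (+-suc C C))))

module _ {V : Set} where

  cnt : {P : V → Set} → (∀ z → Dec (P z)) → List V → ℕ
  cnt P? [] = 0
  cnt P? (a ∷ l) = bit (P? a) + cnt P? l

  module _ {P : V → Set} (P? : ∀ z → Dec (P z)) where

    cnt-++ : ∀ l m → cnt P? (l ++ m) ≡ cnt P? l + cnt P? m
    cnt-++ [] m = refl
    cnt-++ (a ∷ l) m = trans (cong (bit (P? a) +_) (cnt-++ l m)) (sym (+-assoc (bit (P? a)) _ _))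

    cnt-↭ : ∀ {l m} → l ↭ m → cnt P? l ≡ cnt P? m
    cnt-↭ _↭_.refl = refl
    cnt-↭ (_↭_.prep x p) = cong (bit (P? x) +_) (cnt-↭ p)
    cnt-↭ (_↭_.swap x y p) = trans (cong (λ q → bit (P? x) + (bit (P? y) + q)) (cnt-↭ p))
      (solveℕ 3 (λ a b c → a :+ (b :+ c) := b :+ (a :+ c)) refl (bit (P? x)) (bit (P? y)) _)
    cnt-↭ (_↭_.trans p q) = trans (cnt-↭ p) (cnt-↭ q)

    cnt≤length : ∀ l → cnt P? l ≤ length l
    cnt≤length [] = z≤n
    cnt≤length (a ∷ l) = +-mono-≤ (bit≤1 (P? a)) (cnt≤length l)

    cnt-pick : ∀ l → 0 < cnt P? l → ∃ λ z → ∃ λ r → l ↭ z ∷ r × P z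
    cnt-pick (a ∷ l) p with P? a
    ... | yes pa = a , l , ↭-refl , pa
    ... | no _ = let (z , r , q , pz) = cnt-pick l p in
      z , a ∷ r , ↭-trans (prep a q) (_↭_.swap a z ↭-refl) , pz

    cnt-seg : ∀ x n → cnt P? (seg x n) ≡ sumTo n (λ i → bit (P? (x i)))
    cnt-seg x zero = refl
    cnt-seg x (suc n) = cong (bit (P? (x 0)) +_) (cnt-seg (x ∘ suc) n)

    -- The greedy choice of connectors rests on this: as long as the used elements do not account
    -- for all those of `X` that satisfy `P`, the pool still offers one.
    pick : ∀ {X} used pool → used ++ pool ↭ X → cnt P? used < cnt P? X → ∃ λ z → ∃ λ r → pool ↭ z ∷ r × P z
    pick {X} used pool p lt = cnt-pick pool (+-cancelˡ-< (cnt P? used) 0 (cnt P? pool)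
      (subst₂ _<_ (sym (+-identityʳ _)) (trans (sym (cnt-↭ p)) (cnt-++ used pool)) lt))

  ⊑-++ : ∀ {a b X Y : List V} → a ⊑ X → b ⊑ Y → a ++ b ⊑ X ++ Y
  ⊑-++ {a} {b} (r , p) (s , q) = r ++ s , ↭-trans
    (solve↭ 4 (λ a b r s → ((a ⊕ b) ⊕ (r ⊕ s)) ⊜ ((a ⊕ r) ⊕ (b ⊕ s))) ↭-refl a b r s) (++⁺ p q)

  ⊑-prefix : ∀ {Y : List V} l m → l ++ m ⊑ Y → l ⊑ Y
  ⊑-prefix l m = ⊑-trans (m , ↭-refl)

  take-drop : ∀ m (r : List V) → m ≤ length r → ∃ λ a → ∃ λ b → a ++ b ≡ r × length a ≡ m
  take-drop zero r p = [] , r , refl , refl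
  take-drop (suc m) (z ∷ r) (s≤s p) = let (a , b , e , f) = take-drop m r p in z ∷ a , b , cong (z ∷_) e , cong suc f

  ⊑-extend : ∀ {L Y : List V} m → L ⊑ Y → length L + m ≤ length Y → ∃ λ r → length r ≡ m × L ++ r ⊑ Y
  ⊑-extend {L} {Y} m (r , p) le =
    let (a , b , e , f) = take-drop m r (+-cancelˡ-≤ (length L) m (length r)
          (≤-trans le (≤-reflexive (trans (sym (↭-length p)) (length-++ L))))) in
    a , f , b , ↭-trans (↭-reflexive (trans (++-assoc L a b) (cong (L ++_) e))) p

  seg-pair : ∀ (z : ℕ → V) {i i' m} → i < i' → i' < m → z i ∷ z i' ∷ [] ⊑ seg z m
  seg-pair z {zero} {suc i'} {suc m} _ (s≤s lt) with o , refl ← m≤n⇒∃[o]m+o≡n lt =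
    A ++ B , prep (z 0) (↭-trans (↭-sym (shift (z (suc i')) A B)) (↭-reflexive (sym (trans (seg-+ (z ∘ suc) (suc i') o)
      (trans (cong (_++ B) (sym (applyUpTo-∷ʳ (z ∘ suc) i'))) (++-assoc A [ z (suc i') ] B))))))
    where
    A = seg (z ∘ suc) i'
    B = seg (z ∘ suc ∘ (suc i' +_)) o
  seg-pair z {suc i} {suc i'} {suc m} (s≤s lt) (s≤s lt') =
    ⊑-trans (seg-pair (z ∘ suc) lt lt') ([ z 0 ] , ++-comm (seg (z ∘ suc) m) [ z 0 ])

  cnt-none : {P : V → Set} (P? : ∀ z → Dec (P z)) (l : List V) → (∀ {u} → u ∈ l → ¬ P u) → cnt P? l ≡ 0
  cnt-none P? [] h = refl
  cnt-none P? (a ∷ l) h rewrite bit-no (P? a) (h (here refl)) = cnt-none P? l (h ∘ there)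

  -- Each index contributes to at most one of the two counts. The degree arguments of Dirac and
  -- Bondy both end with this comparison.
  cnt-disjoint : {P Q : V → Set} (P? : ∀ z → Dec (P z)) (Q? : ∀ z → Dec (Q z)) (x y : ℕ → V) → ∀ n →
    (∀ i → i < n → P (x i) → ¬ Q (y i)) → cnt P? (seg x n) + cnt Q? (seg y n) ≤ n
  cnt-disjoint P? Q? x y zero h = z≤n
  cnt-disjoint P? Q? x y (suc n) h = ≤-trans (≤-reflexive (ring (bit (P? (x 0))) _ (bit (Q? (y 0))) _))
    (+-mono-≤ (one (P? (x 0)) (Q? (y 0)) (h 0 z<s)) (cnt-disjoint P? Q? (x ∘ suc) (y ∘ suc) n (λ i → h (suc i) ∘ s<s)))
    where
    ring : ∀ a b c d → (a + b) + (c + d) ≡ (a + c) + (b + d)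
    ring = solveℕ 4 (λ a b c d → (a :+ b) :+ (c :+ d) := (a :+ c) :+ (b :+ d)) refl
    one : {A B : Set} (d : Dec A) (e : Dec B) → (A → ¬ B) → bit d + bit e ≤ 1
    one (yes a) (yes b) h = ⊥-elim (h a b)
    one (yes _) (no _) _ = s≤s z≤n
    one (no _) (yes _) _ = s≤s z≤n
    one (no _) (no _) _ = z≤n

cnt-all : {V : Set} {P : V → Set} (P? : ∀ z → Dec (P z)) {l : List V} → All P l → cnt P? l ≡ length l
cnt-all P? [] = refl
cnt-all P? (p ∷ ps) = cong₂ _+_ (bit-yes (P? _) p) (cnt-all P? ps)

-- Parity, pigeonhole and splitting of lists

even-or-odd : ∀ n → ∃ λ i → n ≡ dbl i ⊎ n ≡ suc (dbl i)
even-or-odd zero = 0 , inj₁ refl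
even-or-odd (suc n) with even-or-odd n
... | i , inj₁ e = i , inj₂ (cong suc e)
... | i , inj₂ e = suc i , inj₁ (cong suc e)

dbl-mono : ∀ {a b} → a ≤ b → dbl a ≤ dbl b
dbl-mono z≤n = z≤n
dbl-mono (s≤s p) = s≤s (s≤s (dbl-mono p))

dbl-cancel : ∀ {a b} → dbl a ≤ suc (dbl b) → a ≤ b
dbl-cancel {a} {b} p = half a b (≤-trans p (≤-reflexive (cong suc (dbl≡+ b))))

pigeonhole : ∀ m n {a b} → suc (m + n) ≤ a + b → suc m ≤ a ⊎ suc n ≤ b
pigeonhole m n {a} {b} p with suc m ≤? a
... | yes q = inj₁ q
... | no q with suc n ≤? b
...   | yes r = inj₂ r
...   | no r = ⊥-elim (<⇒≱ p (+-mono-≤ (s≤s⁻¹ (≰⇒> q)) (s≤s⁻¹ (≰⇒> r))))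

split : {A : Set} {P : A → Set} → (∀ z → Dec (P z)) → (l : List A) →
  ∃ λ as → ∃ λ bs → as ++ bs ↭ l × All P as × All (¬_ ∘ P) bs
split P? [] = [] , [] , ↭-refl , [] , []
split P? (z ∷ l) with P? z | split P? l
... | yes p | as , bs , q , pa , pb = z ∷ as , bs , prep z q , p ∷ pa , pb
... | no p | as , bs , q , pa , pb = as , z ∷ bs , ↭-trans (shift z as bs) (prep z q) , pa , p ∷ pb

-- Paths and cycles in a two-coloured complete graph

module Colour {V : Set} (col : V → V → Bool) (col-sym : ∀ x y → col x y ≡ col y x) where

  E : Bool → V → V → Set
  E b x y = col x y ≡ b

  E-sym : ∀ {b x y} → E b x y → E b y x
  E-sym {b} {x} {y} e = trans (col-sym y x) e

  E? : ∀ b x y → Dec (E b x y)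
  E? b x y = col x y ≟ᵇ b

  data Path (b : Bool) : V → List V → V → Set where
    [_]ᵖ : ∀ a → Path b a [ a ] a
    _∷ᵖ_ : ∀ {a a' l z} → E b a a' → Path b a' l z → Path b a (a ∷ l) z

  infixr 5 _∷ᵖ_

  join : ∀ {b a l z a' l' z'} → Path b a l z → E b z a' → Path b a' l' z' → Path b a (l ++ l') z'
  join [ a ]ᵖ e q = e ∷ᵖ q
  join (d ∷ᵖ p) e q = d ∷ᵖ join p e q

  reverseᵖ : ∀ {b a l z} → Path b a l z → Path b z (reverse l) a
  reverseᵖ [ a ]ᵖ = [ a ]ᵖ
  reverseᵖ {a = a} (_∷ᵖ_ {l = l} e p) =
    subst (λ q → Path _ _ q _) (sym (unfold-reverse a l)) (join (reverseᵖ p) (E-sym e) [ a ]ᵖ)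

  seg-path : ∀ {b} x → (∀ i → E b (x i) (x (suc i))) → ∀ n → Path b (x 0) (seg x (suc n)) (x n)
  seg-path x e zero = [ x 0 ]ᵖ
  seg-path x e (suc n) = e 0 ∷ᵖ seg-path (x ∘ suc) (e ∘ suc) n

  record IsCyc (b : Bool) (n : ℕ) (x : ℕ → V) : Set where
    constructor isCyc
    field
      periodic : Periodic n x
      edge : ∀ i → E b (x i) (x (suc i))
  open IsCyc public

  -- A cycle is a periodic sequence of vertices; only one period has to lie in S.
  HasCyc : Bool → ℕ → List V → Set
  HasCyc b n S = ∃ λ x → IsCyc b n x × seg x n ⊑ S

  cyc-shift : ∀ {b n x} → IsCyc b n x → ∀ a → IsCyc b n (x ∘ (_+ a))
  cyc-shift {n = n} {x} c a = isCyc
    (λ i → trans (cong x (+-assoc n i a)) (periodic c (i + a)))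
    (λ i → edge c (i + a))

  ⊑-shift : ∀ {b n x S} → IsCyc b n x → seg x n ⊑ S → ∀ a → seg (x ∘ (_+ a)) n ⊑ S
  ⊑-shift {x = x} c s a = ⊑-resp (↭-sym (seg-shift {x = x} (periodic c) a)) s

  cyc-wrap : ∀ {b n x} → IsCyc b n x → x n ≡ x 0
  cyc-wrap {n = n} {x} c = trans (cong x (sym (+-identityʳ n))) (periodic c 0)

  -- Moving the first vertex of a closed path to the end leaves a closed path; `stream-edge`
  -- iterates this to obtain all edges of the periodic extension.
  rot-edge : ∀ {b a l z} d → Path b a l z → E b z a →
    E b a (hd d (rot l)) × ∃ λ a' → Σ V λ z' → Path b a' (rot l) z' × E b z' a'
  rot-edge d [ a ]ᵖ e = e , a , a , [ a ]ᵖ , e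
  rot-edge d (f ∷ᵖ [ a' ]ᵖ) e = f , a' , _ , e ∷ᵖ [ _ ]ᵖ , f
  rot-edge d (f ∷ᵖ q@(g ∷ᵖ p)) e = f , _ , _ , join q e [ _ ]ᵖ , f

  stream-edge : ∀ {b a l z} d → Path b a l z → E b z a → ∀ i → E b (stream d l i) (stream d l (suc i))
  stream-edge d [ a ]ᵖ e zero = e
  stream-edge d p@(_ ∷ᵖ _) e zero = proj₁ (rot-edge d p e)
  stream-edge d p e (suc i) = let (_ , _ , _ , p' , e') = rot-edge d p e in stream-edge d p' e' i

  close : ∀ {b a l z S} → Path b a l z → E b z a → l ⊑ S → HasCyc b (length l) S
  close {b} {a} {l} {z} p e s = stream a l , isCyc (stream-periodic a l) (stream-edge a p e)
    , subst (_⊑ _) (sym (seg-of-stream a l)) s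

  -- The length of the new cycle is recovered from the vertices r that it leaves out of T.
  close-in : ∀ {b a l z S T n} r → Path b a l z → E b z a → l ++ r ↭ T → length r + n ≡ length T → T ⊑ S → HasCyc b n S
  close-in {l = l} {n = n} r p e q len s = subst (λ k → HasCyc _ k _) eq (close p e (⊑-trans (r , q) s))
    where
    eq : length l ≡ n
    eq = +-cancelˡ-≡ (length r) (length l) n (trans (+-comm (length r) (length l))
      (trans (sym (length-++ l)) (trans (↭-length q) (sym len))))

  ¬E : ∀ {b x y} → ¬ E b x y → E (not b) x y
  ¬E = ¬-not

  E-not-not : ∀ {b x y} → E (not (not b)) x y → E b x y
  E-not-not {b} e = trans e (not-involutive b)

  last-edge : ∀ {b n x} → IsCyc b (suc n) x → E b (x n) (x 0)
  last-edge {b} {n} {x} c = subst (E b (x n)) (cyc-wrap c) (edge c n)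

  edge-+ : ∀ {b n x} → IsCyc b n x → ∀ a i → E b (x (a + i)) (x (a + suc i))
  edge-+ {b} {x = x} c a i = subst (E b (x (a + i)) ∘ x) (sym (+-suc a i)) (edge c (a + i))

  seg-path-at : ∀ {b n x} → IsCyc b n x → ∀ a m → Path b (x a) (seg (x ∘ (a +_)) (suc m)) (x (a + m))
  seg-path-at {b} {x = x} c a m = subst (λ i → Path b (x i) (seg (x ∘ (a +_)) (suc m)) (x (a + m))) (+-identityʳ a)
    (seg-path (x ∘ (a +_)) (edge-+ c a) m)

  -- Shortening a monochromatic cycle by one or two

  -- A chord of colour `b` would bypass `x (suc i)` and close a cycle with one vertex less.
  chord₂ : ∀ {b n x S} → ¬ HasCyc b (2 + n) S → IsCyc b (3 + n) x → seg x (3 + n) ⊑ S →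
    ∀ i → E (not b) (x i) (x (2 + i))
  chord₂ {b} {n} {x} {S} nc c s i = ¬E λ e → nc
    (close-in [ y 1 ] (e ∷ᵖ seg-path (y ∘ (2 +_)) (λ j → edge c' (2 + j)) n) (last-edge c')
      (solve↭ 3 (λ a b c → ((a ⊕ c) ⊕ b) ⊜ (a ⊕ b ⊕ c)) ↭-refl [ y 0 ] [ y 1 ] (seg (y ∘ (2 +_)) (suc n)))
      (sym (length-applyUpTo y (3 + n)))
      (⊑-shift c s i))
    where
    y = x ∘ (_+ i)
    c' = cyc-shift c i

  chord₃ : ∀ {b n x S} → ¬ HasCyc b (2 + n) S → IsCyc b (4 + n) x → seg x (4 + n) ⊑ S →
    ∀ i → E (not b) (x i) (x (3 + i))
  chord₃ {b} {n} {x} {S} nc c s i = ¬E λ e → nc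
    (close-in (y 1 ∷ y 2 ∷ []) (e ∷ᵖ seg-path (y ∘ (3 +_)) (λ j → edge c' (3 + j)) n) (last-edge c')
      (solve↭ 3 (λ a b c → ((a ⊕ c) ⊕ b) ⊜ (a ⊕ b ⊕ c)) ↭-refl [ y 0 ] (y 1 ∷ y 2 ∷ []) (seg (y ∘ (3 +_)) (suc n)))
      (sym (length-applyUpTo y (4 + n)))
      (⊑-shift c s i))
    where
    y = x ∘ (_+ i)
    c' = cyc-shift c i

  -- Steps of two around a cycle of odd length visit the even positions first and, after wrapping
  -- past the end, the odd ones.
  seg-dbl-odd : ∀ (x : ℕ → V) h → Periodic (suc (dbl h)) x → seg (x ∘ dbl) (suc (dbl h)) ↭ seg x (suc (dbl h))
  seg-dbl-odd x h p = ↭-trans (↭-reflexive (trans (cong (seg (x ∘ dbl)) (cong suc (dbl≡+ h)))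
      (trans (seg-+ (x ∘ dbl) (suc h) h) (cong (seg (x ∘ dbl) (suc h) ++_) (seg-cong wrap h)))))
    (prep (x 0) (↭-trans (++-comm (seg (x ∘ suc ∘ suc ∘ dbl) h) _) (seg-deal (x ∘ suc) h)))
    where
    wrap : ∀ i → x (dbl (suc h + i)) ≡ x (suc (dbl i))
    wrap i = trans (cong x (trans (cong (suc ∘ suc) (dbl-+ h i)) (sym (+-suc (suc (dbl h)) (dbl i))))) (p (suc (dbl i)))

  -- If all chords of length 2 have the other colour they form a Hamiltonian cycle, whose own chords of
  -- length 2 are chords of length 4; they give the cycle 0, 4, 5, 1, 2, 6, 7, …, which omits 3.
  shrink-odd : ∀ h S → (∀ b → ¬ HasCyc b (6 + dbl h) S) → ∀ b → ¬ HasCyc b (7 + dbl h) S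
  shrink-odd h S nc b (x , c , s) = nc b
    (close-in [ x 3 ] (x04 ∷ᵖ edge c 4 ∷ᵖ E-sym x15 ∷ᵖ edge c 1 ∷ᵖ x26 ∷ᵖ seg-path (x ∘ (6 +_)) (λ i → edge c (6 + i))
        (dbl h)) (last-edge c)
      (solve↭ 5 (λ a b c d e → ((a ⊕ d ⊕ b ⊕ e) ⊕ c) ⊜ (a ⊕ b ⊕ c ⊕ d ⊕ e)) ↭-refl
         [ x 0 ] (x 1 ∷ x 2 ∷ []) [ x 3 ] (x 4 ∷ x 5 ∷ []) (seg (x ∘ (6 +_)) (suc (dbl h))))
      (sym (length-applyUpTo x (7 + dbl h))) s)
    where
    n = 7 + dbl h
    y = x ∘ dbl
    per : Periodic n y
    per i = trans (cong x (trans (dbl-+ n i) (trans (cong (_+ dbl i) (dbl≡+ n)) (+-assoc n n (dbl i)))))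
      (trans (periodic c (n + dbl i)) (periodic c (dbl i)))
    y-cyc : IsCyc (not b) n y
    y-cyc = isCyc per (λ i → chord₂ (nc b) c s (dbl i))
    s' : seg y n ⊑ S
    s' = ⊑-resp (↭-sym (seg-dbl-odd x (3 + h) (periodic c))) s
    chord₄ : ∀ i → E b (y i) (y (2 + i))
    chord₄ i = E-not-not (chord₂ (nc (not b)) y-cyc s' i)
    x04 = chord₄ 0
    x26 = chord₄ 1
    -- The chord from 1 to 5 starts at position `4 + h` of `y`, because `dbl (4 + h)` is `n + 1`.
    x15 : E b (x 1) (x 5)
    x15 = subst₂ (E b) (trans (cong x (+-comm 1 n)) (periodic c 1)) (trans (cong x (+-comm 5 n)) (periodic c 5))
        (chord₄ (4 + h))

  -- The cycle 2, 4, …, n-2, 1, n-1, n-3, …, 5 uses only chords of lengths 2 and 3 and omits 0 and 3.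
  shrink-even : ∀ h S → (∀ b → ¬ HasCyc b (6 + dbl h) S) → ∀ b → ¬ HasCyc b (8 + dbl h) S
  shrink-even h S nc b (x , c , s) = nc (not b)
    (close-in (x 0 ∷ x 3 ∷ [])
      (join (seg-path (x ∘ dbl ∘ suc) (λ i → two (2 + dbl i)) (2 + h)) edge₁
          (edge₂ ∷ᵖ reverseᵖ (seg-path (x ∘ suc ∘ dbl ∘ (2 +_)) (λ i → two (5 + dbl i)) (suc h))))
      (E-sym (three 2))
      perm
      (sym (length-applyUpTo x n)) s)
    where
    n = 8 + dbl h
    two : ∀ i → E (not b) (x i) (x (2 + i))
    two = chord₂ (shrink-odd h S nc b) c s
    three : ∀ i → E (not b) (x i) (x (3 + i))
    three = chord₃ (nc b) c s
    edge₁ : E (not b) (x (6 + dbl h)) (x 1)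
    edge₁ = subst (E (not b) (x (6 + dbl h))) (trans (cong x (+-comm 1 n)) (periodic c 1)) (three (6 + dbl h))
    edge₂ : E (not b) (x 1) (x (7 + dbl h))
    edge₂ = E-sym (subst (E (not b) (x (7 + dbl h))) (trans (cong x (+-comm 1 n)) (periodic c 1)) (two (7 + dbl h)))
    ev = seg (x ∘ dbl ∘ suc) (3 + h)
    od = seg (x ∘ suc ∘ dbl ∘ (2 +_)) (2 + h)
    perm : (ev ++ x 1 ∷ reverse od) ++ x 0 ∷ x 3 ∷ [] ↭ seg x n
    perm = ↭-trans (++⁺ʳ (x 0 ∷ x 3 ∷ []) (++⁺ˡ ev (prep (x 1) (↭-reverse od))))
      (↭-trans (solve↭ 5 (λ e o a b c → ((e ⊕ b ⊕ o) ⊕ a ⊕ c) ⊜ ((a ⊕ e) ⊕ (b ⊕ c ⊕ o))) ↭-refl ev od [ x 0 ] [ x 1 ]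
          [ x 3 ])
        (seg-deal x (4 + h)))

  -- A longest monochromatic cycle and the vertices outside it

  module Longest {b : Bool} {c' : ℕ} {x : ℕ → V} {Y S : List V}
    (cyc : IsCyc b (suc c') x) (perm : seg x (suc c') ++ Y ↭ S)
    (longest : ∀ n → suc c' < n → ∀ b' → ¬ HasCyc b' n S) where

    c : ℕ
    c = suc c'

    X : List V
    X = seg x c

    -- The colour `b` of the cycle is called red below, the colour `k` blue.
    k : Bool
    k = not b

    perm-shift : ∀ a → seg (x ∘ (_+ a)) c ++ Y ↭ S
    perm-shift a = ↭-trans (++⁺ʳ Y (seg-shift {x = x} (periodic cyc) a)) perm

    x-back : ∀ i → x (c' + suc i) ≡ x i
    x-back i = trans (cong x (+-suc c' i)) (periodic cyc i)

    -- The path through outside vertices could replace the edge from `x i` to `x (suc i)`, which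
    -- gives a longer red cycle.
    detour₁ : ∀ {p l q} i → Path b p l q → l ⊑ Y → 1 ≤ length l → E b p (x i) → ¬ E b q (x (suc i))
    detour₁ {p} {l} {q} i P s len e f = longest (length (l ++ seg x' c))
      (subst (c <_) (sym (trans (length-++ l) (cong (length l +_) (length-applyUpTo x' c)))) (+-monoˡ-≤ c len))
      b (close (join P f (seg-path x' (edge cyc') c')) (E-sym (subst (E b p) (sym (x-back i)) e))
        (⊑-trans (⊑-++ s ⊑-refl) ([] , ↭-trans (++-identityʳ _) (↭-trans (++-comm Y _) (perm-shift (suc i))))))
      where
      x' = x ∘ (_+ suc i)
      cyc' = cyc-shift cyc (suc i)

    -- Two or more outside vertices in place of the single vertex `x (suc i)` would lengthen the
    -- cycle.
    detour₂ : ∀ {p l q c''} → c' ≡ suc c'' → ∀ i → Path b p l q → l ⊑ Y → 2 ≤ length l → E b p (x i) → ¬ E b q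
        (x (2 + i))
    detour₂ {p} {l} {q} {c''} refl i P s len e f = longest (length (l ++ seg x' c'))
      (subst (c <_) (sym (trans (length-++ l) (cong (length l +_) (length-applyUpTo x' c')))) (+-monoˡ-≤ c' len))
      b (close (join P f (seg-path x' (edge cyc') c''))
        (E-sym (subst (E b p) (sym (trans (cong x (+-suc c'' (suc i))) (x-back i))) e))
        (⊑-trans (⊑-++ s ⊑-refl) ([ x (suc i) ] , ↭-trans
          (solve↭ 3 (λ y s a → ((y ⊕ s) ⊕ a) ⊜ ((a ⊕ s) ⊕ y)) ↭-refl Y (seg x' c') [ x (suc i) ])
          (↭-trans (++⁺ʳ Y (↭-reflexive (cong (x (suc i) ∷_) (seg-cong (λ j → cong x (+-suc j (suc i))) c'))))
              (perm-shift (suc i))))))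
      where
      x' = x ∘ (_+ suc (suc i))
      cyc' = cyc-shift cyc (suc (suc i))

    -- As positions of Y, the two entries of a pair are distinct.
    Pair : V → V → Set
    Pair y y' = y ∷ y' ∷ [] ⊑ Y

    pair-sym : ∀ {y y'} → Pair y y' → Pair y' y
    pair-sym = ⊑-resp (_↭_.swap _ _ ↭-refl)

    pair₁ : ∀ {y y'} → Pair y y' → [ y ] ⊑ Y
    pair₁ {y} {y'} = ⊑-prefix [ y ] [ y' ]

    not-consecutive : ∀ {y} → [ y ] ⊑ Y → ∀ i → E b y (x i) → ¬ E b y (x (suc i))
    not-consecutive s i = detour₁ i [ _ ]ᵖ s (s≤s z≤n)

    red-not-crossing : ∀ {y y'} → Pair y y' → E b y y' → ∀ i → ¬ (E b y (x i) × E b y' (x (suc i)))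
    red-not-crossing s e i (f , g) = detour₁ i (e ∷ᵖ [ _ ]ᵖ) s (s≤s z≤n) f g

    -- Two crossings with the same orientation allow y and y' to be inserted together.
    crossing-once : ∀ {y y'} → Pair y y' → ∀ d i → 0 < d → d < c →
      E b y (x i) × E b y' (x (suc i)) → ¬ (E b y (x (d + i)) × E b y' (x (suc (d + i))))
    crossing-once {y} {y'} s (suc e) i _ d<c (p , p') (q , q') with f , eq ← m≤n⇒∃[o]m+o≡n d<c =
      longest (2 + c) (s≤s (n≤1+n c)) b
        -- With indices relative to `i`, the new cycle is `y`, d, d - 1, ..., 1, `y'`, d + 1, ...,
        -- c, where c is again 0.
        (close-in [] (q ∷ᵖ join (reverseᵖ (seg-path (z ∘ suc) (λ j → edge cyc' (suc j)) e)) (E-sym p')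
            (q' ∷ᵖ seg-path-at cyc' (suc (suc e)) f))
          (E-sym (subst (E b y) (sym (trans (cong z eq) (cyc-wrap cyc'))) p))
          list-perm
          (cong (suc ∘ suc) (sym (length-applyUpTo x c)))
          (⊑-trans (⊑-++ s ⊑-refl) ([] , ↭-trans (++-identityʳ _) (↭-trans (++-comm Y X) perm))))
      where
      z = x ∘ (_+ i)
      cyc' = cyc-shift cyc i
      A = seg (z ∘ suc) (suc e)
      B = seg (z ∘ (suc (suc e) +_)) (suc f)
      eq' : suc e + suc f ≡ c
      eq' = trans (cong suc (+-suc e f)) eq
      list-perm : (y ∷ reverse A ++ y' ∷ B) ++ [] ↭ y ∷ y' ∷ X
      list-perm = ↭-trans (++⁺ʳ [] (prep y (++⁺ʳ (y' ∷ B) (↭-reverse A))))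
        (↭-trans (solve↭ 4 (λ y y' a b → ((y ⊕ a ⊕ y' ⊕ b) ⊕ Perm.id) ⊜ (y ⊕ y' ⊕ a ⊕ b)) ↭-refl [ y ] [ y' ] A B)
          (prep y (prep y' (↭-trans (↭-reflexive
              (trans (sym (seg-+ (z ∘ suc) (suc e) (suc f))) (cong (seg (z ∘ suc)) eq')))
            (↭-trans (seg-rotate z c (cyc-wrap cyc'))
              (seg-shift {x = x} (periodic cyc) i))))))

    common? : ∀ y y' z → Dec (E k y z × E k y' z)
    common? y y' z = E? k y z ×-dec E? k y' z

    commons : V → V → ℕ
    commons y y' = cnt (common? y y') X

    module Count {y y' : V} (s : Pair y y') where

      Crossing : V → V → ℕ → Set
      Crossing u v i = E b u (x i) × E b v (x (suc i))

      Crossing? : ∀ u v i → Dec (Crossing u v i)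
      Crossing? u v i = E? b u (x i) ×-dec E? b v (x (suc i))

      shared t₁ t₂ : ℕ → ℕ
      shared i = bit (common? y y' (x i))
      t₁ i = bit (Crossing? y y' i)
      t₂ i = bit (Crossing? y' y i)

      -- If neither end of the cycle edge is a common blue neighbour, each end is red to `y` or
      -- `y'`. By `not-consecutive` these are not the same outside vertex, so there is a crossing.
      cover : ∀ i → 1 ≤ shared i + (shared (suc i) + (t₁ i + t₂ i))
      cover i with E? b y (x i)
      ... | yes p = ≤-trans (help (E? b y' (x (suc i)))) (m≤n+m _ (shared i))
        where
        help : Dec (E b y' (x (suc i))) → 1 ≤ shared (suc i) + (bit (yes p ×-dec E? b y' (x (suc i))) + t₂ i)
        help (yes q) rewrite bit-yes (yes p ×-dec E? b y' (x (suc i))) (p , q) = ≤-trans (m≤m+n 1 _)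
            (m≤n+m _ (shared (suc i)))
        help (no q) rewrite bit-yes (common? y y' (x (suc i))) (¬E (not-consecutive (pair₁ s) i p) , ¬E q) = s≤s z≤n
      ... | no p with E? b y' (x i)
      ...   | no q rewrite bit-yes (common? y y' (x i)) (¬E p , ¬E q) = s≤s z≤n
      ...   | yes q = ≤-trans (help (E? b y (x (suc i)))) (m≤n+m _ (shared i))
        where
        help : Dec (E b y (x (suc i))) → 1 ≤ shared (suc i) +
            (bit (no p ×-dec E? b y' (x (suc i))) + bit (yes q ×-dec E? b y (x (suc i))))
        help (yes r) rewrite bit-yes (yes q ×-dec E? b y (x (suc i))) (q , r) = ≤-trans
            (m≤n+m 1 (bit (no p ×-dec E? b y' (x (suc i))))) (m≤n+m _ (shared (suc i)))
        help (no r) rewrite bit-yes (common? y y' (x (suc i)))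
            (¬E r , ¬E (not-consecutive (pair₁ (pair-sym s)) i q)) = s≤s z≤n

      sum-s : ∀ a → sumTo c (λ i → shared (i + a)) ≡ commons y y'
      sum-s a = trans (sym (cnt-seg (common? y y') (x ∘ (_+ a)) c)) (cnt-↭ (common? y y')
        (seg-shift {x = x} (periodic cyc) a))

      sum-s₀ : sumTo c shared ≡ commons y y'
      sum-s₀ = sym (cnt-seg (common? y y') x c)

      sum-s₁ : sumTo c (shared ∘ suc) ≡ commons y y'
      sum-s₁ = trans (sym (cnt-seg (common? y y') (x ∘ suc) c)) (cnt-↭ (common? y y') (seg-rotate x c (cyc-wrap cyc)))

      -- Sum `cover` over all cycle edges; a common neighbour is counted once for each of its two
      -- cycle edges.
      total : c ≤ commons y y' + (commons y y' + (sumTo c t₁ + sumTo c t₂))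
      total = ≤-trans (sumTo-≥ c _ (λ i _ → cover i)) (≤-reflexive
        (trans (sumTo-+ c shared (λ i → shared (suc i) + (t₁ i + t₂ i)))
            (cong₂ _+_ sum-s₀ (trans (sumTo-+ c (shared ∘ suc) (λ i → t₁ i + t₂ i))
                (cong₂ _+_ sum-s₁ (sumTo-+ c t₁ t₂))))))

      once : ∀ {u v} → Pair u v → sumTo c (λ i → bit (Crossing? u v i)) ≤ 1
      once {u} {v} s' = sumTo-once (Crossing? u v) c λ i j i<j j<c p q → crossing-once s' (j ∸ i) i (m<n⇒0<n∸m i<j)
        (≤-<-trans (m∸n≤m j i) j<c) p (subst (Crossing u v) (sym (m∸n+n≡m (<⇒≤ i<j))) q)

      bound : c ≤ commons y y' + (commons y y' + 2)
      bound = ≤-trans total (+-monoʳ-≤ (commons y y')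
          (+-monoʳ-≤ (commons y y') (+-mono-≤ (once s) (once (pair-sym s)))))

      bound₀ : (∀ i → ¬ Crossing y y' i) → (∀ i → ¬ Crossing y' y i) → c ≤ commons y y' + commons y y'
      bound₀ n₁ n₂ = ≤-trans total (≤-reflexive (cong (commons y y' +_) (trans (cong (commons y y' +_)
        (cong₂ _+_ (sumTo-none (Crossing? y y') c (λ i _ → n₁ i)) (sumTo-none (Crossing? y' y) c (λ i _ → n₂ i))))
            (+-identityʳ _))))

      bound-red : E b y y' → c ≤ commons y y' + commons y y'
      bound-red e = bound₀ (red-not-crossing s e) (red-not-crossing (pair-sym s) (E-sym e))

      -- A red pair has no crossings, so the common neighbours alone cover the cycle edges. The edge
      -- at `a` is covered by both ends, and this makes the inequality strict.
      bound-strict : E b y y' → ∀ a → E k y (x a) × E k y' (x a) → E k y (x (suc a)) × E k y' (x (suc a)) →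
          c < commons y y' + commons y y'
      bound-strict e a p q = ≤-trans
        (+-mono-≤ (≤-reflexive (sym (cong₂ _+_ (bit-yes (common? y y' (x a)) p)
            (bit-yes (common? y y' (x (suc a))) q))))
          (sumTo-≥ c' (λ i → shared (suc i + a) + shared (suc (suc i) + a)) (λ i _ → cover₀ (suc i + a))))
        (≤-reflexive (trans (sumTo-+ c (λ i → shared (i + a)) (λ i → shared (suc i + a)))
          (cong₂ _+_ (sum-s a) (trans (sym (sumTo-cong c (λ i → cong shared (+-suc i a)))) (sum-s (suc a))))))
        where
        cover₀ : ∀ i → 1 ≤ shared i + shared (suc i)
        cover₀ i = ≤-trans (cover i) (+-monoʳ-≤ (shared i) (≤-reflexive (trans (cong (shared (suc i) +_) (cong₂ _+_
          (bit-no (Crossing? y y' i) (red-not-crossing s e i))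
              (bit-no (Crossing? y' y i) (red-not-crossing (pair-sym s) (E-sym e) i))))
          (+-identityʳ _))))
        sumTo-cong : ∀ n {f g : ℕ → ℕ} → (∀ i → f i ≡ g i) → sumTo n f ≡ sumTo n g
        sumTo-cong zero p = refl
        sumTo-cong (suc n) p = cong₂ _+_ (p 0) (sumTo-cong n (p ∘ suc))

    -- Blue cycles through outside vertices and their common neighbours

    finish : ∀ {a l z} p q → Path k a l z → E k z a → l ↭ p ++ q → p ⊑ Y → q ⊑ X → ¬ c < length p + length q
    finish {l = l} p q P e s sp sq lt = longest (length l)
      (subst (c <_) (sym (trans (↭-length s) (length-++ p))) lt) k
      (close P e (⊑-resp (↭-sym s) (⊑-trans (⊑-++ sp sq) ([] , ↭-trans (++-identityʳ _) (↭-trans (++-comm Y X) perm)))))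

    -- Consecutive outside vertices are linked greedily: a gap with at least H common neighbours on the
    -- cycle can be filled as long as fewer than H of them are in use.
    module Fill (H : ℕ) (dense : ∀ {y y'} → Pair y y' → H ≤ commons y y') where

      fill : ∀ y₀ ys yₑ used pool → used ++ pool ↭ X → y₀ ∷ ys ++ [ yₑ ] ⊑ Y → length used + suc (length ys) ≤ H →
        ∃ λ l → ∃ λ new → ∃ λ pool' → Path k y₀ l yₑ × l ↭ (y₀ ∷ ys ++ [ yₑ ]) ++ new ×
          (new ++ used) ++ pool' ↭ X × length new ≡ suc (length ys)
      fill y₀ [] yₑ used pool p s le
        with z , r , q , e , f ← pick (common? y₀ yₑ) used pool p
              (≤-<-trans (cnt≤length (common? y₀ yₑ) used)
                  (<-≤-trans (≤-trans (≤-reflexive (+-comm 1 (length used))) le) (dense s)))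
        = y₀ ∷ z ∷ yₑ ∷ [] , [ z ] , r , (e ∷ᵖ E-sym f ∷ᵖ [ yₑ ]ᵖ) ,
        prep y₀ (_↭_.swap z yₑ ↭-refl) ,
        ↭-trans (solve↭ 3 (λ z u r → ((z ⊕ u) ⊕ r) ⊜ (u ⊕ (z ⊕ r))) ↭-refl [ z ] used r)
            (↭-trans (++⁺ˡ used (↭-sym q)) p) , refl
      fill y₀ (y ∷ ys) yₑ used pool p s le
        with z , r , q , e , f ← pick (common? y₀ y) used pool p
              (≤-<-trans (cnt≤length (common? y₀ y) used) (<-≤-trans (≤-trans (≤-reflexive (+-comm 1 (length used)))
                (≤-trans (+-monoʳ-≤ (length used) (s≤s z≤n)) le)) (dense (⊑-prefix (y₀ ∷ y ∷ []) (ys ++ [ yₑ ]) s))))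
        with l , new , pool' , P , lp , np , len ← fill y ys yₑ (z ∷ used) r
              (↭-trans (solve↭ 3 (λ z u r → ((z ⊕ u) ⊕ r) ⊜ (u ⊕ (z ⊕ r))) ↭-refl [ z ] used r)
                  (↭-trans (++⁺ˡ used (↭-sym q)) p))
              (⊑-trans ([ y₀ ] , ++-comm (y ∷ ys ++ [ yₑ ]) [ y₀ ]) s)
              (≤-trans (≤-reflexive (sym (+-suc (length used) (suc (length ys))))) le)
        = y₀ ∷ z ∷ l , new ++ [ z ] , pool' , (e ∷ᵖ E-sym f ∷ᵖ P) ,
        prep y₀ (↭-trans (prep z lp) (solve↭ 3 (λ z a n → (z ⊕ (a ⊕ n)) ⊜ (a ⊕ (n ⊕ z))) ↭-refl [ z ]
            (y ∷ ys ++ [ yₑ ]) new)) ,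
        ↭-trans (solve↭ 4 (λ n z u r → (((n ⊕ z) ⊕ u) ⊕ r) ⊜ ((n ⊕ (z ⊕ u)) ⊕ r)) ↭-refl new [ z ] used pool') np ,
        trans (length-++ new) (trans (+-comm (length new) 1) (cong suc len))

    snoc-length : ∀ {n} (l : List V) (z : V) → length l ≡ n → length (l ++ [ z ]) ≡ suc n
    snoc-length l z e = trans (length-++ l) (trans (+-comm (length l) 1) (cong suc e))

    dbl-length : ∀ m n h → m + n + (h + h) ≡ m + h + (n + h)
    dbl-length = solveℕ 3 (λ m n h → m :+ n :+ (h :+ h) := m :+ h :+ (n :+ h)) refl

    longer : ∀ {c} m n h {p q : ℕ} → c < m + n + dbl h → p ≡ m + h → q ≡ n + h → c < p + q
    longer {c} m n h c< ep eq = subst (c <_)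
        (trans (cong (m + n +_) (dbl≡+ h)) (trans (dbl-length m n h) (sym (cong₂ _+_ ep eq)))) c<

    -- Otherwise `2 + h` outside vertices form a blue path from `y` to `y'` with `1 + h` connectors,
    -- and one more common neighbour of `y` and `y'` closes it to a cycle on `4 + dbl h` vertices.
    good-pair : ∀ h → (∀ {y y'} → Pair y y' → suc h ≤ commons y y') → c < 4 + dbl h → 2 + h ≤ length Y →
      ∀ {y y'} → Pair y y' → ¬ 2 + h ≤ commons y y'
    good-pair h dense c< le {y} {y'} s good
      with r , lr , sr ← ⊑-extend h s le
      with sr' ← ⊑-resp (solve↭ 3 (λ a b r → ((a ⊕ b) ⊕ r) ⊜ (a ⊕ r ⊕ b)) ↭-refl [ y ] [ y' ] r) sr
      with l , new , pool' , P , lp , np , len ← Fill.fill (suc h) dense y r y' [] X ↭-refl sr'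
          (≤-reflexive (cong suc lr))
      with np' ← ↭-trans (++⁺ʳ pool' (↭-sym (++-identityʳ new))) np
      with len' ← trans len (cong suc lr)
      with z , t , q , e , f ← pick (common? y y') new pool' np'
              (≤-<-trans (cnt≤length (common? y y') new) (<-≤-trans (≤-reflexive (cong suc len')) good))
      = finish (y ∷ r ++ [ y' ]) (new ++ [ z ]) (join P f [ z ]ᵖ) (E-sym e)
          (↭-trans (++⁺ʳ [ z ] lp) (solve↭ 3 (λ a n z → ((a ⊕ n) ⊕ z) ⊜ (a ⊕ (n ⊕ z))) ↭-refl (y ∷ r ++ [ y' ]) new
              [ z ]))
          sr' (t , ↭-trans (solve↭ 3 (λ n z t → ((n ⊕ z) ⊕ t) ⊜ (n ⊕ (z ⊕ t))) ↭-refl new [ z ] t)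
              (↭-trans (++⁺ˡ new (↭-sym q)) np'))
          (longer 2 2 h c< (cong suc (snoc-length r y' lr)) (snoc-length new z len'))

    -- The blue edge serves as one of the `3 + h` gaps between `3 + h` outside vertices. Of the
    -- remaining `2 + h` gaps, the one between `z` and `y` is filled last, by a surplus common
    -- neighbour; the cycle has `5 + dbl h` vertices.
    blue-good : ∀ h → (∀ {y y'} → Pair y y' → suc h ≤ commons y y') → c < 5 + dbl h → 3 + h ≤ length Y →
      ∀ {y y' z} → y' ∷ z ∷ y ∷ [] ⊑ Y → E k y y' → ¬ 2 + h ≤ commons z y
    blue-good h dense c< le {y} {y'} {z} s blue good
      with r , lr , sr ← ⊑-extend h s le
      with sr' ← ⊑-resp (solve↭ 4 (λ a b c r → ((a ⊕ b ⊕ c) ⊕ r) ⊜ ((a ⊕ r ⊕ b) ⊕ c)) ↭-refl [ y' ] [ z ] [ y ] r) sr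
      with l , new , pool' , P , lp , np , len ← Fill.fill (suc h) dense y' r z [] X ↭-refl
          (⊑-prefix (y' ∷ r ++ [ z ]) [ y ] sr') (≤-reflexive (cong suc lr))
      with np' ← ↭-trans (++⁺ʳ pool' (↭-sym (++-identityʳ new))) np
      with len' ← trans len (cong suc lr)
      with w , t , q , e , f ← pick (common? z y) new pool' np'
              (≤-<-trans (cnt≤length (common? z y) new) (<-≤-trans (≤-reflexive (cong suc len')) good))
      = finish ((y' ∷ r ++ [ z ]) ++ [ y ]) (new ++ [ w ]) (join P e (E-sym f ∷ᵖ [ y ]ᵖ)) blue
          (↭-trans (++⁺ʳ (w ∷ y ∷ []) lp)
              (solve↭ 4 (λ a n w y → ((a ⊕ n) ⊕ (w ⊕ y)) ⊜ ((a ⊕ y) ⊕ (n ⊕ w))) ↭-refl (y' ∷ r ++ [ z ]) new [ w ]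
                  [ y ]))
          sr' (t , ↭-trans (solve↭ 3 (λ n z t → ((n ⊕ z) ⊕ t) ⊜ (n ⊕ (z ⊕ t))) ↭-refl new [ w ] t)
              (↭-trans (++⁺ˡ new (↭-sym q)) np'))
          (longer 3 2 h c< (snoc-length (y' ∷ r ++ [ z ]) y (cong suc (snoc-length r z lr))) (snoc-length new w len'))

    -- Three blue edges save three connectors: `4 + h` outside vertices and `1 + h` connectors form
    -- a blue cycle.
    blue-path₄ : ∀ h → (∀ {y y'} → Pair y y' → suc h ≤ commons y y') → c < 5 + dbl h → 4 + h ≤ length Y →
      ∀ {y₀ y₁ w w'} → y₀ ∷ y₁ ∷ w ∷ w' ∷ [] ⊑ Y → E k y₁ w → E k w w' → ¬ E k w' y₀
    blue-path₄ h dense c< le {y₀} {y₁} {w} {w'} s e₁ e₂ e₃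
      with r , lr , sr ← ⊑-extend h s le
      with sr' ← ⊑-resp (solve↭ 4 (λ a b c r → ((a ⊕ b ⊕ c) ⊕ r) ⊜ ((a ⊕ r ⊕ b) ⊕ c)) ↭-refl [ y₀ ] [ y₁ ]
          (w ∷ w' ∷ []) r) sr
      with l , new , pool' , P , lp , np , len ← Fill.fill (suc h) dense y₀ r y₁ [] X ↭-refl
          (⊑-prefix (y₀ ∷ r ++ [ y₁ ]) (w ∷ w' ∷ []) sr') (≤-reflexive (cong suc lr))
      = finish ((y₀ ∷ r ++ [ y₁ ]) ++ (w ∷ w' ∷ [])) new
          (join P e₁ (e₂ ∷ᵖ [ w' ]ᵖ)) e₃
          (↭-trans (++⁺ʳ (w ∷ w' ∷ []) lp)
              (solve↭ 3 (λ a n w → ((a ⊕ n) ⊕ w) ⊜ ((a ⊕ w) ⊕ n)) ↭-refl (y₀ ∷ r ++ [ y₁ ]) new (w ∷ w' ∷ [])))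
          sr' (pool' , ↭-trans (++⁺ʳ pool' (↭-sym (++-identityʳ new))) np)
          (longer 4 1 h c< (trans (length-++ (y₀ ∷ r ++ [ y₁ ]))
              (trans (+-comm _ 2) (cong (2 +_) (cong suc (snoc-length r y₁ lr)))))
            (trans len (cong suc lr)))

    -- Spending z, useless for the pair y₁, y₃, on the first gap leaves one connector more for the closing gap.
    special-connector : ∀ h → (∀ {y y'} → Pair y y' → 2 + h ≤ commons y y') → c < 6 + dbl h → 3 + h ≤ length Y →
      ∀ {y₁ y₂ y₃} → y₁ ∷ y₂ ∷ y₃ ∷ [] ⊑ Y → ∀ z → [ z ] ⊑ X → E k y₁ z → E k y₂ z → ¬ ¬ E k y₃ z
    special-connector h dense c< le {y₁} {y₂} {y₃} s z (X' , zX) e₁ e₂ ne₃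
      with r , lr , sr ← ⊑-extend h s le
      with sr' ← ⊑-resp (solve↭ 4 (λ a b c r → ((a ⊕ b ⊕ c) ⊕ r) ⊜ (a ⊕ (b ⊕ r ⊕ c))) ↭-refl [ y₁ ] [ y₂ ] [ y₃ ] r) sr
      with l , new , pool' , P , lp , np , len ← Fill.fill (2 + h) dense y₂ r y₃ [ z ] X' zX
             (⊑-trans ([ y₁ ] , ++-comm (y₂ ∷ r ++ [ y₃ ]) [ y₁ ]) sr') (≤-reflexive (cong (2 +_) lr))
      with len' ← trans len (cong suc lr)
      with w , t , q , e , f ← pick (common? y₁ y₃) (new ++ [ z ]) pool' np
              (<-≤-trans (s≤s (subst (_≤ suc h) (sym (trans (cnt-++ (common? y₁ y₃) new [ z ])
                 (trans (cong (cnt (common? y₁ y₃) new +_) (cong (_+ 0) (bit-no (common? y₁ y₃ z) (ne₃ ∘ proj₂))))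
                     (+-identityʳ _))))
                 (≤-trans (cnt≤length (common? y₁ y₃) new) (≤-reflexive len'))))
                (dense (⊑-trans ([ y₂ ] , solve↭ 3 (λ a b c → ((a ⊕ c) ⊕ b) ⊜ (a ⊕ b ⊕ c)) ↭-refl [ y₁ ] [ y₂ ]
                    [ y₃ ]) s)))
      = finish (y₁ ∷ y₂ ∷ r ++ [ y₃ ]) ((new ++ [ z ]) ++ [ w ])
          (e₁ ∷ᵖ E-sym e₂ ∷ᵖ join P f [ w ]ᵖ) (E-sym e)
          (prep y₁ (↭-trans (prep z (++⁺ʳ [ w ] lp))
              (solve↭ 4 (λ a n w z → (z ⊕ ((a ⊕ n) ⊕ w)) ⊜ (a ⊕ ((n ⊕ z) ⊕ w))) ↭-refl (y₂ ∷ r ++ [ y₃ ]) new [ w ]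
                  [ z ])))
          sr' (t , ↭-trans (solve↭ 3 (λ n z t → ((n ⊕ z) ⊕ t) ⊜ (n ⊕ (z ⊕ t))) ↭-refl (new ++ [ z ]) [ w ] t)
              (↭-trans (++⁺ˡ (new ++ [ z ]) (↭-sym q)) np))
          (longer 3 3 h c< (cong (2 +_) (snoc-length r y₃ lr)) (snoc-length (new ++ [ z ]) w (snoc-length new z len')))

    -- Lengthening a longest cycle of even and of odd length

    seg-∈ : ∀ i → [ x i ] ⊑ X
    seg-∈ i = ⊑-trans (seg (x ∘ suc ∘ (_+ i)) c' , ↭-refl)
      ([] , ↭-trans (++-identityʳ _) (seg-shift {x = x} (periodic cyc) i))

    E-not : ∀ {u v} → E b u v → ¬ E k u v
    E-not e f = not-¬ e f

    -- First, all outside pairs are red. Then a red edge to `x a` forces one to `x (2 + a)`, so of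
    -- any two outside vertices one is `Full`; but two `Full` vertices would lengthen the red cycle,
    -- and among three outside vertices there are two.
    step-even : ∀ h → c ≡ 4 + dbl h → ¬ 4 + h ≤ length Y
    step-even h eq le = conclude
      where
      c< : c < 5 + dbl h
      c< = ≤-reflexive (cong suc eq)
      le₃ : 3 + h ≤ length Y
      le₃ = ≤-trans (n≤1+n _) le
      dense : ∀ {y y'} → Pair y y' → suc h ≤ commons y y'
      dense {y} {y'} s = half (suc h) (commons y y') (m≤n⇒m≤1+n (+-cancelʳ-≤ 2 _ _
        (≤-trans (≤-reflexive (trans (+-comm (dbl (suc h)) 2) (sym eq)))
            (≤-trans (Count.bound s) (≤-reflexive (sym (+-assoc (commons y y') (commons y y') 2)))))))
      dense-red : ∀ {y y'} → Pair y y' → E b y y' → 2 + h ≤ commons y y'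
      dense-red {y} {y'} s e = half (2 + h) (commons y y')
          (m≤n⇒m≤1+n (≤-trans (≤-reflexive (sym eq)) (Count.bound-red s e)))
      -- If `y` and `z` were red, they would have the surplus common neighbour that `blue-good`
      -- excludes.
      triple : ∀ {y y' z} → y' ∷ z ∷ y ∷ [] ⊑ Y → E k y y' → E k y z
      triple {y} {y'} {z} s e = ¬E λ red → blue-good h dense c< le₃ s e
        (dense-red (⊑-trans ([ y' ] , ++-comm (z ∷ y ∷ []) [ y' ]) s) (E-sym red))
      all-red : ∀ {y y'} → Pair y y' → E b y y'
      all-red {z} {w} s = E-not-not (¬E λ blue → let
          (r , lr , sr) = ⊑-extend 2 s (≤-trans (m≤m+n 4 h) le) in four r lr sr blue)
        where
        -- A blue pair spreads by `triple` to two further vertices, which yields the blue path `z`,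
        -- `w`, `v`, `u`.
        four : ∀ r → length r ≡ 2 → z ∷ w ∷ r ⊑ Y → ¬ E k z w
        four (u ∷ v ∷ []) refl s zw = blue-path₄ h dense c< le
            (⊑-resp (solve↭ 4 (λ z w u v → (z ⊕ w ⊕ u ⊕ v) ⊜ (u ⊕ z ⊕ w ⊕ v)) ↭-refl [ z ] [ w ] [ u ] [ v ]) s) zw wv
                (E-sym uv)
          where
          zu : E k z u
          zu = triple (⊑-trans ([ v ] , solve↭ 4 (λ z w u v → ((w ⊕ u ⊕ z) ⊕ v) ⊜ (z ⊕ w ⊕ u ⊕ v)) ↭-refl [ z ] [ w ]
              [ u ] [ v ]) s) zw
          wv : E k w v
          wv = triple (⊑-trans ([ u ] , solve↭ 4 (λ z w u v → ((z ⊕ v ⊕ w) ⊕ u) ⊜ (z ⊕ w ⊕ u ⊕ v)) ↭-refl [ z ] [ w ]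
              [ u ] [ v ]) s) (E-sym zw)
          uv : E k u v
          uv = triple (⊑-trans ([ w ] , solve↭ 4 (λ z w u v → ((z ⊕ v ⊕ u) ⊕ w) ⊜ (z ⊕ w ⊕ u ⊕ v)) ↭-refl [ z ] [ w ]
              [ u ] [ v ]) s) (E-sym zu)
      dense' : ∀ {y y'} → Pair y y' → 2 + h ≤ commons y y'
      dense' s = dense-red s (all-red s)
      no-gap : ∀ {y y'} → Pair y y' → ∀ a → E k y (x a) × E k y' (x a) → ¬ (E k y (x (suc a)) × E k y' (x (suc a)))
      no-gap {y} {y'} s a p q = good-pair (suc h) dense' (m≤n⇒m≤1+n c<) le₃ s
        (half (3 + h) (commons y y') (s≤s
            (≤-trans (≤-reflexive (cong suc (sym eq))) (Count.bound-strict s (all-red s) a p q))))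
      two-apart : ∀ {y y'} → Pair y y' → ∀ a → E b y (x a) → ¬ E b y' (x (2 + a))
      two-apart s a e f = detour₂ (suc-injective eq) a (all-red s ∷ᵖ [ _ ]ᵖ) s ≤-refl e f
      -- Otherwise `x (suc a)` and `x (2 + a)` would both be common blue neighbours of `y` and `y'`.
      next : ∀ {y y'} → Pair y y' → ∀ a → E b y (x a) → E b y (x (2 + a))
      next {y} {y'} s a e = E-not-not (¬E λ f → no-gap s (suc a)
        (¬E (not-consecutive (pair₁ s) a e) , ¬E λ g → red-not-crossing s (all-red s) a (e , g))
        (f , ¬E (two-apart s a e)))
      Full : V → Set
      Full y = (E b y (x 0) × E b y (x 2)) ⊎ (E b y (x 1) × E b y (x 3))
      full : ∀ {y y'} → Pair y y' → Full y ⊎ Full y'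
      full {y} {y'} s with E? b y (x 0) | E? b y' (x 0) | E? b y (x 1) | E? b y' (x 1)
      ... | yes e | _ | _ | _ = inj₁ (inj₁ (e , next s 0 e))
      ... | no _ | yes e | _ | _ = inj₂ (inj₁ (e , next (pair-sym s) 0 e))
      ... | no _ | no _ | yes e | _ = inj₁ (inj₂ (e , next s 1 e))
      ... | no _ | no _ | no _ | yes e = inj₂ (inj₂ (e , next (pair-sym s) 1 e))
      ... | no e | no f | no g | no i = ⊥-elim (no-gap s 0 (¬E e , ¬E f) (¬E g , ¬E i))
      not-two-full : ∀ {y y'} → Pair y y' → Full y → ¬ Full y'
      not-two-full s (inj₁ (e , _)) (inj₁ (_ , f)) = two-apart s 0 e f
      not-two-full s (inj₁ (e , _)) (inj₂ (f , _)) = red-not-crossing s (all-red s) 0 (e , f)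
      not-two-full s (inj₂ (e , _)) (inj₁ (f , _)) = red-not-crossing (pair-sym s) (all-red (pair-sym s)) 0 (f , e)
      not-two-full s (inj₂ (e , _)) (inj₂ (_ , f)) = two-apart s 1 e f
      conclude : ⊥
      conclude with (y₁ ∷ y₂ ∷ y₃ ∷ []) , refl , s ← ⊑-extend {L = []} 3 (Y , ↭-refl) (≤-trans (m≤m+n 3 h) le₃)
        with p₁₂ ← ⊑-prefix (y₁ ∷ y₂ ∷ []) [ y₃ ] s
        with p₂₃ ← ⊑-trans {l = y₂ ∷ y₃ ∷ []} ([ y₁ ] , ++-comm (y₂ ∷ y₃ ∷ []) [ y₁ ]) s
        with p₁₃ ← ⊑-trans {l = y₁ ∷ y₃ ∷ []} ([ y₂ ] , prep y₁ (_↭_.swap y₃ y₂ ↭-refl)) s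
        with full p₁₂
      ... | inj₁ f₁ = [ not-two-full p₁₂ f₁ , not-two-full p₁₃ f₁ ]′ (full p₂₃)
      ... | inj₂ f₂ = [ (λ f₁ → not-two-full p₁₂ f₁ f₂) , not-two-full p₂₃ f₂ ]′ (full p₁₃)

    -- All outside pairs are blue. For a triangle, four outside vertices therefore form a longer
    -- blue cycle. For greater length a third outside vertex rules out the crossings of the other
    -- two, which then have too many common neighbours.
    step-odd : ∀ h → c ≡ 3 + dbl h → 2 + h ≤ length Y → ¬ (h ≡ 0 → 4 ≤ length Y)
    step-odd h eq le four = conclude h eq le four no-good
      where
      dense : ∀ {y y'} → Pair y y' → suc h ≤ commons y y'
      dense {y} {y'} s = half (suc h) (commons y y') (+-cancelʳ-≤ 2 _ _
        (≤-trans (≤-reflexive (+-comm (dbl (suc h)) 2))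
            (s≤s (≤-trans (≤-reflexive (sym eq))
                (≤-trans (Count.bound s) (≤-reflexive (sym (+-assoc (commons y y') (commons y y') 2))))))))
      no-good : ∀ {y y'} → Pair y y' → ¬ c ≤ commons y y' + commons y y'
      no-good {y} {y'} s le' = good-pair h dense (≤-reflexive (cong suc eq)) le s
        (half (2 + h) (commons y y') (s≤s (≤-trans (≤-reflexive (sym eq)) le')))
      all-blue : ∀ {y y'} → Pair y y' → E k y y'
      all-blue s = ¬E λ e → no-good s (Count.bound-red s e)
      conclude : ∀ h → c ≡ 3 + dbl h → 2 + h ≤ length Y → (h ≡ 0 → 4 ≤ length Y) →
          (∀ {y y'} → Pair y y' → ¬ c ≤ commons y y' + commons y y') → ⊥
      conclude zero eq le four no-good with (y₁ ∷ y₂ ∷ y₃ ∷ y₄ ∷ []) , refl , s ← ⊑-extend {L = []} 4 (Y , ↭-refl)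
          (four refl) =
        finish (y₁ ∷ y₂ ∷ y₃ ∷ y₄ ∷ []) []
          (all-blue (⊑-prefix (y₁ ∷ y₂ ∷ []) (y₃ ∷ y₄ ∷ []) s) ∷ᵖ
           all-blue (⊑-trans (y₁ ∷ y₄ ∷ [] , solve↭ 4 (λ z w u v → ((w ⊕ u) ⊕ z ⊕ v) ⊜ (z ⊕ w ⊕ u ⊕ v)) ↭-refl [ y₁ ]
               [ y₂ ] [ y₃ ] [ y₄ ]) s) ∷ᵖ
           all-blue (⊑-trans (y₁ ∷ y₂ ∷ [] , ++-comm (y₃ ∷ y₄ ∷ []) (y₁ ∷ y₂ ∷ [])) s) ∷ᵖ [ y₄ ]ᵖ)
          (all-blue (⊑-trans (y₂ ∷ y₃ ∷ [] , solve↭ 4 (λ z w u v → ((v ⊕ z) ⊕ w ⊕ u) ⊜ (z ⊕ w ⊕ u ⊕ v)) ↭-refl [ y₁ ]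
              [ y₂ ] [ y₃ ] [ y₄ ]) s))
          (↭-sym (++-identityʳ _)) s (X , ↭-refl) (s≤s (≤-reflexive eq))
      conclude (suc h₁) eq le _ no-good with (y₁ ∷ y₂ ∷ y₃ ∷ []) , refl , s ← ⊑-extend {L = []} 3 (Y , ↭-refl)
          (≤-trans (m≤m+n 3 h₁) le) =
        no-good (⊑-prefix (y₁ ∷ y₂ ∷ []) [ y₃ ] s) (Count.bound₀ (⊑-prefix (y₁ ∷ y₂ ∷ []) [ y₃ ] s) (no-crossing s)
          (no-crossing (⊑-resp (_↭_.swap y₁ y₂ ↭-refl) s)))
        where
        dense' : ∀ {y y'} → Pair y y' → 2 + h₁ ≤ commons y y'
        dense' {y} {y'} s = half (2 + h₁) (commons y y') (+-cancelʳ-≤ 2 _ _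
          (≤-trans (≤-reflexive (+-comm (dbl (2 + h₁)) 2))
              (s≤s (≤-trans (≤-reflexive (sym eq))
                  (≤-trans (Count.bound s) (≤-reflexive (sym (+-assoc (commons y y') (commons y y') 2))))))))
        common : ∀ {y₁ y₂ y₃} → y₁ ∷ y₂ ∷ y₃ ∷ [] ⊑ Y → ∀ i → E k y₁ (x i) → E k y₂ (x i) → ¬ E b y₃ (x i)
        common s i e f g = special-connector h₁ dense' (≤-reflexive (cong suc eq)) le s (x i) (seg-∈ i) e f (E-not g)
        -- By `common`, the third vertex would have to be red to both `x i` and `x (suc i)`.
        no-crossing : ∀ {y₁ y₂ y₃} → y₁ ∷ y₂ ∷ y₃ ∷ [] ⊑ Y → ∀ i → ¬ (E b y₁ (x i) × E b y₂ (x (suc i)))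
        no-crossing {y₁} {y₂} {y₃} s i (e , f) = not-consecutive
            (⊑-trans (y₁ ∷ y₂ ∷ [] , ++-comm [ y₃ ] (y₁ ∷ y₂ ∷ [])) s) i
          (E-not-not (¬E λ g → common (⊑-resp
              (solve↭ 3 (λ a b c → (a ⊕ b ⊕ c) ⊜ (b ⊕ c ⊕ a)) ↭-refl [ y₁ ] [ y₂ ] [ y₃ ]) s) i
             (¬E λ e' → not-consecutive (⊑-trans (y₁ ∷ y₃ ∷ [] , _↭_.swap y₂ y₁ ↭-refl) s) i e' f) g e))
          (E-not-not (¬E λ g → common (⊑-resp (prep y₁ (_↭_.swap y₂ y₃ ↭-refl)) s) (suc i)
             (¬E (not-consecutive (⊑-prefix [ y₁ ] (y₂ ∷ y₃ ∷ []) s) i e)) g f))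

  -- Monochromatic triangles and the Ramsey number of an even cycle

  -- Either two of the three neighbours form a triangle with `v`, or all three form one in the other
  -- colour.
  no-star : ∀ {S b v u₁ u₂ u₃} → (∀ b → ¬ HasCyc b 3 S) → v ∷ u₁ ∷ u₂ ∷ u₃ ∷ [] ⊑ S → E b v u₁ → E b v u₂ → ¬ E b v u₃
  no-star {S} {b} {v} {u₁} {u₂} {u₃} nc s e₁ e₂ e₃ = nc (not b) (close
      (¬E (λ f → nc b (close (e₁ ∷ᵖ f ∷ᵖ [ u₂ ]ᵖ) (E-sym e₂) (⊑-prefix (v ∷ u₁ ∷ u₂ ∷ []) [ u₃ ] s))) ∷ᵖ
       ¬E (λ f → nc b (close (e₂ ∷ᵖ f ∷ᵖ [ u₃ ]ᵖ) (E-sym e₃)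
           (⊑-trans ([ u₁ ] , prep v (++-comm (u₂ ∷ u₃ ∷ []) [ u₁ ])) s))) ∷ᵖ [ u₃ ]ᵖ)
      (¬E (λ f → nc b (close (e₃ ∷ᵖ f ∷ᵖ [ u₁ ]ᵖ) (E-sym e₁)
        (⊑-trans ([ u₂ ] , prep v (solve↭ 3 (λ a b c → ((c ⊕ a) ⊕ b) ⊜ (a ⊕ b ⊕ c)) ↭-refl [ u₁ ] [ u₂ ] [ u₃ ])) s))))
      (⊑-trans ([ v ] , ++-comm (u₁ ∷ u₂ ∷ u₃ ∷ []) [ v ]) s))

  no-big-star : ∀ {S b v} as → (∀ b → ¬ HasCyc b 3 S) → 3 ≤ length as → All (E b v) as → ¬ v ∷ as ⊑ S
  no-big-star {v = v} (a₁ ∷ a₂ ∷ a₃ ∷ as) nc _ (e₁ ∷ e₂ ∷ e₃ ∷ _) s =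
    no-star nc (⊑-prefix (v ∷ a₁ ∷ a₂ ∷ a₃ ∷ []) as s) e₁ e₂ e₃
  no-big-star (_ ∷ _ ∷ []) nc (s≤s (s≤s ()))
  no-big-star (_ ∷ []) nc (s≤s ())

  triangle : ∀ S → 6 ≤ length S → ¬ (∀ b → ¬ HasCyc b 3 S)
  triangle (v ∷ S) (s≤s le) nc with as , bs , p , pa , pb ← split (E? true v) S =
    [ (λ le₃ → no-big-star as nc le₃ pa (bs , prep v p))
    , (λ le₃ → no-big-star bs nc le₃ (All.map ¬E pb) (as , prep v (↭-trans (++-comm bs as) p))) ]′
    (pigeonhole 2 2 {length as} {length bs} (≤-trans le (≤-reflexive (trans (sym (↭-length p)) (length-++ as)))))

  module _ (j : ℕ) (S : List V) (large : 8 + (j + dbl j) ≤ length S) (nc : ∀ b → ¬ HasCyc b (6 + dbl j) S) where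

    none-even : ∀ i b → ¬ HasCyc b (6 + dbl (i + j)) S
    none-even zero = nc
    none-even (suc i) = shrink-even (i + j) S (none-even i)

    none-large : ∀ n → 6 + dbl j ≤ n → ∀ b → ¬ HasCyc b n S
    none-large n le b with o , refl ← m≤n⇒∃[o]m+o≡n le with even-or-odd o
    ... | i , inj₁ refl = subst (λ q → ¬ HasCyc b (6 + q) S) (trans (dbl-+ i j) (+-comm (dbl i) (dbl j)))
        (none-even i b)
    ... | i , inj₂ refl = subst (λ q → ¬ HasCyc b (6 + q) S)
        (trans (cong suc (trans (dbl-+ i j) (+-comm (dbl i) (dbl j)))) (sym (+-suc (dbl j) (dbl i))))
      (shrink-odd (i + j) S (none-even i) b)

    outside : ∀ c (x : ℕ → V) Y → seg x c ++ Y ↭ S → ∀ m → c + m ≤ 8 + (j + dbl j) → m ≤ length Y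
    outside c x Y p m le = +-cancelˡ-≤ c m (length Y) (≤-trans le (≤-trans large (≤-reflexive
      (trans (sym (↭-length p)) (trans (length-++ (seg x c)) (cong (_+ length Y) (length-applyUpTo x c)))))))

    -- Induction on `d`, a bound on how far `c` lies below the length excluded by assumption. All
    -- longer cycles are already ruled out, so a cycle of length `c` is longest and can be
    -- lengthened.
    none : ∀ d c → 3 ≤ c → 6 + dbl j ≤ c + d → ∀ b → ¬ HasCyc b c S
    none zero c _ le = none-large c (≤-trans le (≤-reflexive (+-identityʳ c)))
    none (suc d) c le₃ le b cy with 6 + dbl j ≤? c
    ... | yes le' = none-large c le' b cy
    ... | no nle with x , cyc , Y , p ← cy with o , refl ← m≤n⇒∃[o]m+o≡n le₃ with even-or-odd o
    ...   | h , inj₁ refl = Longest.step-odd cyc p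
              (λ n lt → none d n (≤-trans le₃ (<⇒≤ lt))
                  (≤-trans le (≤-trans (≤-reflexive (+-suc _ d)) (+-monoˡ-≤ d lt)))) h refl
              -- In the extreme case `h = suc j` the cycle has `5 + dbl j` vertices and `3 + j` are
              -- needed outside, which is exactly what the size of `S` guarantees.
              (outside (3 + dbl h) x Y p (2 + h) (≤-trans (+-mono-≤ (s≤s (s≤s (s≤s (dbl-mono h≤)))) (s≤s (s≤s h≤)))
                (≤-reflexive (ring j (dbl j)))))
              (λ { refl → outside 3 x Y p 4 (s≤s (s≤s (s≤s (s≤s (s≤s (s≤s (s≤s z≤n))))))) })
      where
      h≤ : h ≤ suc j
      h≤ = dbl-cancel (m≤n⇒m≤1+n (s≤s⁻¹ (s≤s⁻¹ (s≤s⁻¹ (s≤s⁻¹ (≰⇒> nle))))))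
      ring : ∀ j d → (5 + d) + (3 + j) ≡ 8 + (j + d)
      ring = solveℕ 2 (λ j d → (con 5 :+ d) :+ (con 3 :+ j) := con 8 :+ (j :+ d)) refl
    ...   | h , inj₂ refl = Longest.step-even cyc p
              (λ n lt → none d n (≤-trans le₃ (<⇒≤ lt))
                  (≤-trans le (≤-trans (≤-reflexive (+-suc _ d)) (+-monoˡ-≤ d lt)))) h refl
              (outside (4 + dbl h) x Y p (4 + h)
                  (≤-trans (+-mono-≤ (s≤s (s≤s (s≤s (s≤s (dbl-mono h≤))))) (s≤s (s≤s (s≤s (s≤s h≤)))))
                (≤-reflexive (ring j (dbl j)))))
      where
      h≤ : h ≤ j
      h≤ = dbl-cancel (s≤s⁻¹ (s≤s⁻¹ (s≤s⁻¹ (s≤s⁻¹ (s≤s⁻¹ (≰⇒> nle))))))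
      ring : ∀ j d → (4 + d) + (4 + j) ≡ 8 + (j + d)
      ring = solveℕ 2 (λ j d → (con 4 :+ d) :+ (con 4 :+ j) := con 8 :+ (j :+ d)) refl

    -- By `none` not even triangles are monochromatic, although six vertices already force one.
    even-ramsey : ⊥
    even-ramsey = triangle S (≤-trans (m≤m+n 6 (2 + (j + dbl j))) large)
      (λ b → none (6 + dbl j) 3 ≤-refl (m≤n+m _ 3) b)

  -- A red cycle one longer than the forbidden odd length

  -- Both chords together give the cycle 0, d + 1, d, ..., 1, d + 3, ..., n, which omits only d + 2.
  cross₀ : ∀ {b n x S} → (∀ b → ¬ HasCyc b n S) → IsCyc b (suc n) x → seg x (suc n) ⊑ S →
    ∀ d f → 3 + d + f ≡ n → E b (x 0) (x (suc d)) → ¬ E b (x 1) (x (3 + d))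
  cross₀ {b} {n} {x} {S} nc cyc s d f refl e₁ e₂ = nc b
    (close-in [ x (2 + d) ] (e₁ ∷ᵖ join (reverseᵖ (seg-path (x ∘ suc) (edge cyc ∘ suc) d)) e₂
        (seg-path-at cyc (3 + d) f)) (last-edge cyc)
      (↭-trans (prep (x 0) (++⁺ʳ _ (++⁺ʳ B (↭-reverse A))))
        (↭-trans (solve↭ 4 (λ x a b y → ((x ⊕ a ⊕ b) ⊕ y) ⊜ (x ⊕ (a ⊕ y) ⊕ b)) ↭-refl [ x 0 ] A B [ x (2 + d) ])
          (↭-reflexive (trans (cong (λ q → (x 0 ∷ q) ++ B) (applyUpTo-∷ʳ (x ∘ suc) (suc d)))
            (trans (sym (seg-+ x (3 + d) (suc f))) (cong (seg x) (+-suc (3 + d) f)))))))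
      (sym (length-applyUpTo x (suc n))) s)
    where
    A = seg (x ∘ suc) (suc d)
    B = seg (x ∘ (3 + d +_)) (suc f)

  cross : ∀ {b n x S} → (∀ b → ¬ HasCyc b n S) → IsCyc b (suc n) x → seg x (suc n) ⊑ S →
    ∀ i d f → 3 + d + f ≡ n → E b (x i) (x (suc d + i)) → ¬ E b (x (suc i)) (x (3 + d + i))
  cross nc cyc s i = cross₀ nc (cyc-shift cyc i) (⊑-shift cyc s i)

  record Clique (b : Bool) (l : List V) : Set where
    constructor clique
    field adjacent : ∀ {u v} → u ∷ v ∷ [] ⊑ l → E b u v
  open Clique

  clique-⊑ : ∀ {b l m} → l ⊑ m → Clique b m → Clique b l
  clique-⊑ s c = clique λ p → adjacent c (⊑-trans p s)

  clique-path : ∀ {b} a l z → Clique b (a ∷ l ++ [ z ]) → Path b a (a ∷ l ++ [ z ]) z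
  clique-path a [] z c = adjacent c ⊑-refl ∷ᵖ [ z ]ᵖ
  clique-path a (a' ∷ l) z c = adjacent c (l ++ [ z ] , ↭-refl) ∷ᵖ clique-path a' l z
      (clique-⊑ ([ a ] , ++-comm (a' ∷ l ++ [ z ]) [ a ]) c)

  seg-clique : ∀ {b} (z : ℕ → V) m → (∀ i t → i + suc t < m → E b (z i) (z (i + suc t))) → Clique b (seg z m)
  seg-clique {b} z m h = clique λ (r , p) → All.head
      (AllPairs.head (AllPairs-resp-↭ (setoid V) E-sym (subst (E b _) , subst (λ q → E b q _)) (↭⇒↭ₛ (↭-sym p)) pairs))
    where
    pairs : AllPairs (E b) (seg z m)
    pairs = AllPairsₚ.applyUpTo⁺₁ z m λ {i} {i'} lt lt' → let (o , eq) = m≤n⇒∃[o]m+o≡n lt ; eq' = trans (+-suc i o) eq in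
      subst (E b (z i) ∘ z) eq' (h i o (subst (_< m) (sym eq') lt'))

  module EvenCycle {b j S x} (nc : ∀ b → ¬ HasCyc b (7 + dbl j) S)
    (cyc : IsCyc b (8 + dbl j) x) (s : seg x (8 + dbl j) ⊑ S) where

    n : ℕ
    n = 8 + dbl j

    k : Bool
    k = not b

    Ev Od : List V
    Ev = seg (x ∘ dbl) (4 + j)
    Od = seg (x ∘ suc ∘ dbl) (4 + j)

    Ev++Od : Ev ++ Od ↭ seg x n
    Ev++Od = seg-deal x (4 + j)

    two : ∀ i → E k (x i) (x (2 + i))
    two = chord₂ (nc b) cyc s

    -- A red chord 0, d makes 1, d + 2 and -1, d - 2 blue, and these link the blue cycle on the odd
    -- vertices with the blue path on the even vertices other than d.
    long-chord : ∀ e f → e + f ≡ j → ¬ E b (x 0) (x (4 + dbl e))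
    long-chord e f refl red = nc k
      (close-in [ x d ]
        (join (seg-path (y ∘ dbl ∘ suc) (λ i → two (2 + dbl i + d)) (2 + j))
          (subst (λ q → E k q (x (7 + dbl j))) (sym back) (E-sym blue₂))
          (reverseᵖ (seg-path (x ∘ suc ∘ dbl) (λ i → two (suc (dbl i))) (3 + j))))
        blue₁
        perm
        (sym (length-applyUpTo x n)) s)
      where
      d = 4 + dbl e
      y = x ∘ (_+ d)
      back : y (dbl (3 + j)) ≡ x (2 + dbl e)
      back = trans (cong x (ring (dbl j) (dbl e))) (periodic cyc (2 + dbl e))
        where
        ring : ∀ j e → (6 + j) + (4 + e) ≡ (8 + j) + (2 + e)
        ring = solveℕ 2 (λ j e → (con 6 :+ j) :+ (con 4 :+ e) := (con 8 :+ j) :+ (con 2 :+ e)) refl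
      dj : dbl j ≡ dbl e + dbl f
      dj = dbl-+ e f
      blue₁ : E k (x 1) (x (2 + d))
      blue₁ = ¬E (cross₀ nc cyc s (3 + dbl e) (1 + dbl f)
        (trans (solveℕ 2 (λ e f → (con 6 :+ e) :+ (con 1 :+ f) := con 7 :+ (e :+ f)) refl (dbl e) (dbl f))
            (cong (7 +_) (sym dj))) red)
      blue₂ : E k (x (7 + dbl j)) (x (2 + dbl e))
      blue₂ = ¬E λ e₂ → cross nc cyc s (7 + dbl j) (2 + dbl e) (2 + dbl f)
        (trans (solveℕ 2 (λ e f → (con 5 :+ e) :+ (con 2 :+ f) := con 7 :+ (e :+ f)) refl (dbl e) (dbl f))
            (cong (7 +_) (sym dj)))
        (subst (E b (x (7 + dbl j))) (sym
            (trans (cong x (solveℕ 2 (λ j e → (con 3 :+ e) :+ (con 7 :+ j) := (con 8 :+ j) :+ (con 2 :+ e)) refl (dbl j)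
                (dbl e))) (periodic cyc (2 + dbl e)))) e₂)
        (subst₂ (E b) (sym (cyc-wrap cyc))
            (sym (trans (cong x (solveℕ 2 (λ j e → (con 5 :+ e) :+ (con 7 :+ j) := (con 8 :+ j) :+ (con 4 :+ e)) refl
                (dbl j) (dbl e))) (periodic cyc (4 + dbl e)))) red)
      ev-periodic : Periodic (4 + j) (x ∘ dbl)
      ev-periodic i = trans (cong x (dbl-+ (4 + j) i)) (periodic cyc (dbl i))
      perm : (seg (y ∘ dbl ∘ suc) (3 + j) ++ reverse Od) ++ [ x d ] ↭ seg x n
      perm = ↭-trans (++⁺ʳ [ x d ] (++⁺ˡ (seg (y ∘ dbl ∘ suc) (3 + j)) (↭-reverse Od)))
        (↭-trans (solve↭ 3 (λ a o d → ((a ⊕ o) ⊕ d) ⊜ ((d ⊕ a) ⊕ o)) ↭-refl (seg (y ∘ dbl ∘ suc) (3 + j)) Od [ x d ])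
        (↭-trans (++⁺ʳ Od (↭-trans (↭-reflexive (seg-cong (λ i → cong x (sym (dbl-+ i (2 + e)))) (4 + j)))
          (seg-shift {x = x ∘ dbl} ev-periodic (2 + e)))) Ev++Od))

    -- The smallest and the largest distance are chords of length two around the cycle; `long-chord`
    -- treats those between.
    even-chord₀ : ∀ t → t < 3 + j → E k (x 0) (x (dbl (suc t)))
    even-chord₀ zero _ = two 0
    even-chord₀ (suc e) (s≤s (s≤s lt)) with m≤n⇒m<n∨m≡n lt
    ... | inj₂ refl = E-sym (subst (E k (x (6 + dbl j))) (cyc-wrap cyc) (two (6 + dbl j)))
    ... | inj₁ (s≤s lt') = let (f , eq) = m≤n⇒∃[o]m+o≡n lt' in ¬E (long-chord e f eq)

  module Structure {b j S x} (nc : ∀ b → ¬ HasCyc b (7 + dbl j) S)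
    (cyc : IsCyc b (8 + dbl j) x) (s : seg x (8 + dbl j) ⊑ S) where

    open EvenCycle nc cyc s using (n; k; Ev; Od; Ev++Od)

    even-chord : ∀ a t → t < 3 + j → E k (x a) (x (dbl (suc t) + a))
    even-chord a = EvenCycle.even-chord₀ nc (cyc-shift cyc a) (⊑-shift cyc s a)

    ev-clique : Clique k Ev
    ev-clique = seg-clique (x ∘ dbl) (4 + j) λ i t lt →
      subst (E k (x (dbl i)) ∘ x) (trans (sym (dbl-+ (suc t) i)) (cong dbl (+-comm (suc t) i)))
        (even-chord (dbl i) t (s≤s⁻¹ (≤-trans (s≤s (m≤n+m (suc t) i)) lt)))

    od-clique : Clique k Od
    od-clique = seg-clique (x ∘ suc ∘ dbl) (4 + j) λ i t lt →
      subst (E k (x (suc (dbl i))) ∘ x)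
          (trans (+-suc (dbl (suc t)) (dbl i)) (cong suc (trans (sym (dbl-+ (suc t) i)) (cong dbl (+-comm (suc t) i)))))
        (even-chord (suc (dbl i)) t (s≤s⁻¹ (≤-trans (s≤s (m≤n+m (suc t) i)) lt)))

    -- The two edges would connect a path through the whole even clique with a path through all but
    -- one of the odd vertices, a blue cycle of the forbidden length `(4 + j) + (3 + j)`.
    blue-matching : ∀ {e e' o o'} → e ∷ e' ∷ [] ⊑ Ev → o ∷ o' ∷ [] ⊑ Od → E k e o → ¬ E k e' o'
    blue-matching {e} {e'} {o} {o'} se so eo e'o'
      with r , lr , sr ← ⊑-extend (2 + j) se (≤-reflexive (sym (length-applyUpTo (x ∘ dbl) (4 + j))))
      with r' , lr' , sr' ← ⊑-extend (1 + j) so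
          (≤-trans (n≤1+n (3 + j)) (≤-reflexive (sym (length-applyUpTo (x ∘ suc ∘ dbl) (4 + j)))))
      with A ← ⊑-resp (solve↭ 3 (λ a b r → ((a ⊕ b) ⊕ r) ⊜ (a ⊕ r ⊕ b)) ↭-refl [ e ] [ e' ] r) sr
      with B ← ⊑-resp (solve↭ 3 (λ a b r → ((a ⊕ b) ⊕ r) ⊜ (b ⊕ r ⊕ a)) ↭-refl [ o ] [ o' ] r') sr'
      = nc k (subst (λ m → HasCyc k m S) len
          (close (join (clique-path e r e' (clique-⊑ A ev-clique)) e'o' (clique-path o' r' o (clique-⊑ B od-clique)))
              (E-sym eo)
            (⊑-trans (⊑-++ A B) (⊑-resp (↭-sym Ev++Od) s))))
      where
      len : length ((e ∷ r ++ [ e' ]) ++ (o' ∷ r' ++ [ o ])) ≡ 7 + dbl j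
      len = trans (length-++ (e ∷ r ++ [ e' ]))
          (trans (cong₂ (λ p q → suc p + suc q) (trans (length-++ r) (cong (_+ 1) lr))
              (trans (length-++ r') (cong (_+ 1) lr')))
        (trans (solveℕ 1 (λ j → (con 1 :+ ((con 2 :+ j) :+ con 1)) :+ (con 1 :+ ((con 1 :+ j) :+ con 1)) := con 7 :+
            (j :+ j)) refl j)
          (cong (7 +_) (sym (dbl≡+ j)))))

    module _ {y : V} (sy : y ∷ seg x n ⊑ S) where

      rotated : seg (x ∘ suc) n ↭ seg x n
      rotated = seg-rotate x n (cyc-wrap cyc)

      size : 2 + (7 + dbl j) ≡ length (y ∷ seg x n)
      size = cong suc (sym (length-applyUpTo x n))

      -- Two disjoint edges between the cliques turn out blue, against `blue-matching`: if one were
      -- red, `y` would lie on a red cycle omitting two of the `x i`. The same plan serves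
      -- `not-odd-apart`.
      not-adjacent : E b y (x 0) → ¬ E b y (x 1)
      not-adjacent e₀ e₁ = blue-matching
          (seg-pair (x ∘ dbl) {0} {2 + j} z<s (n≤1+n _))
          (seg-pair (x ∘ suc ∘ dbl) {2 + j} {3 + j} ≤-refl ≤-refl)
          -- Red would give the cycle `y`, 1, ..., 5 + 2j, 0.
          (¬E λ red → nc b (close-in (x (6 + dbl j) ∷ x (7 + dbl j) ∷ [])
            (e₁ ∷ᵖ join (seg-path (x ∘ suc) (edge cyc ∘ suc) (4 + dbl j)) (E-sym red) [ x 0 ]ᵖ) (E-sym e₀)
            (prep y (↭-trans (solve↭ 4 (λ a z p q → ((a ⊕ z) ⊕ p ⊕ q) ⊜ (z ⊕ ((a ⊕ p) ⊕ q))) ↭-refl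
                (seg (x ∘ suc) (5 + dbl j)) [ x 0 ] [ x (6 + dbl j) ] [ x (7 + dbl j) ])
              (↭-reflexive (cong (x 0 ∷_) (trans (cong (_++ [ x (7 + dbl j) ]) (applyUpTo-∷ʳ (x ∘ suc) (5 + dbl j)))
                  (applyUpTo-∷ʳ (x ∘ suc) (6 + dbl j)))))))
            size sy))
          -- Red would give the cycle `y`, 1, ..., 4 + 2j, 7 + 2j, 0.
          (¬E λ red → nc b (close-in (x (5 + dbl j) ∷ x (6 + dbl j) ∷ [])
            (e₁ ∷ᵖ join (seg-path (x ∘ suc) (edge cyc ∘ suc) (3 + dbl j)) red (last-edge cyc ∷ᵖ [ x 0 ]ᵖ)) (E-sym e₀)
            (prep y (↭-trans (solve↭ 5 (λ a z p q r → ((a ⊕ r ⊕ z) ⊕ p ⊕ q) ⊜ (z ⊕ (((a ⊕ p) ⊕ q) ⊕ r))) ↭-refl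
                (seg (x ∘ suc) (4 + dbl j)) [ x 0 ] [ x (5 + dbl j) ] [ x (6 + dbl j) ] [ x (7 + dbl j) ])
              (↭-reflexive (cong (x 0 ∷_) (trans
                  (cong (λ q → (q ++ [ x (6 + dbl j) ]) ++ [ x (7 + dbl j) ]) (applyUpTo-∷ʳ (x ∘ suc) (4 + dbl j)))
                (trans (cong (_++ [ x (7 + dbl j) ]) (applyUpTo-∷ʳ (x ∘ suc) (5 + dbl j)))
                    (applyUpTo-∷ʳ (x ∘ suc) (6 + dbl j))))))))
            size sy))

      not-odd-apart : ∀ e f → e + f ≡ 1 + j → E b y (x 0) → ¬ E b y (x (3 + dbl e))
      not-odd-apart e f eq e₀ eₑ = blue-matching
          (seg-pair (x ∘ dbl) {1} {2 + e} (s≤s z<s) (s≤s (s≤s e<)))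
          (⊑-resp (_↭_.swap _ _ ↭-refl) (seg-pair (x ∘ suc ∘ dbl) {1} {2 + e} (s≤s z<s) (s≤s (s≤s e<))))
          -- Red would give the cycle `y`, 3 + 2e, ..., 2, 5 + 2e, ..., n, where n is again 0.
          (¬E λ red → nc b (close-in (x 1 ∷ x (4 + dbl e) ∷ [])
            (eₑ ∷ᵖ join (reverseᵖ (seg-path (x ∘ (2 +_)) (λ i → edge cyc (2 + i)) (1 + dbl e))) red
                (seg-path-at cyc (5 + dbl e) (1 + dbl f)))
            (E-sym (subst (E b y) (sym (end-eq
                (solveℕ 2 (λ e f → (con 5 :+ e) :+ (con 1 :+ f) := con 6 :+ (e :+ f)) refl (dbl e) (dbl f)))) e₀))
            (prep y (↭-trans (++⁺ʳ _ (++⁺ʳ B (↭-reverse A)))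
                (↭-trans (solve↭ 4 (λ a b p q → ((a ⊕ b) ⊕ p ⊕ q) ⊜ (p ⊕ (a ⊕ q) ⊕ b)) ↭-refl A B [ x 1 ]
                    [ x (4 + dbl e) ])
              (↭-trans (↭-reflexive (cong (x 1 ∷_) (trans (cong (_++ B) (applyUpTo-∷ʳ (x ∘ (2 +_)) (2 + dbl e)))
                (trans (sym (seg-+ (x ∘ (2 +_)) (3 + dbl e) (2 + dbl f))) (cong (seg (x ∘ (2 +_)))
                  (trans (solveℕ 2 (λ e f → (con 3 :+ e) :+ (con 2 :+ f) := con 5 :+ (e :+ f)) refl (dbl e) (dbl f))
                      (cong (5 +_) sum-eq)))))))
                rotated))))
            size sy))
          -- Red would give the cycle `y`, 3 + 2e, ..., 3, 4 + 2e, ..., n.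
          (¬E λ red → nc b (close-in (x 1 ∷ x 2 ∷ [])
            (eₑ ∷ᵖ join (reverseᵖ (seg-path (x ∘ (3 +_)) (λ i → edge cyc (3 + i)) (dbl e))) (E-sym red)
                (seg-path-at cyc (4 + dbl e) (2 + dbl f)))
            (E-sym (subst (E b y) (sym (end-eq
                (solveℕ 2 (λ e f → (con 4 :+ e) :+ (con 2 :+ f) := con 6 :+ (e :+ f)) refl (dbl e) (dbl f)))) e₀))
            (prep y (↭-trans (++⁺ʳ _ (++⁺ʳ B' (↭-reverse A'))) (↭-trans (++-comm (A' ++ B') (x 1 ∷ x 2 ∷ []))
              (↭-trans (↭-reflexive (cong (λ q → x 1 ∷ x 2 ∷ q)
                  (trans (sym (seg-+ (x ∘ (3 +_)) (1 + dbl e) (3 + dbl f)))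
                (cong (seg (x ∘ (3 +_))) (trans
                    (solveℕ 2 (λ e f → (con 1 :+ e) :+ (con 3 :+ f) := con 4 :+ (e :+ f)) refl (dbl e) (dbl f))
                        (cong (4 +_) sum-eq))))))
                rotated))))
            size sy))
        where
        A = seg (x ∘ (2 +_)) (2 + dbl e)
        B = seg (x ∘ (5 + dbl e +_)) (2 + dbl f)
        A' = seg (x ∘ (3 +_)) (1 + dbl e)
        B' = seg (x ∘ (4 + dbl e +_)) (3 + dbl f)
        sum-eq : dbl e + dbl f ≡ 2 + dbl j
        sum-eq = trans (sym (dbl-+ e f)) (cong dbl eq)
        end-eq : ∀ {m} → m ≡ 6 + (dbl e + dbl f) → x m ≡ x 0
        end-eq p = trans (cong x (trans p (cong (6 +_) sum-eq))) (cyc-wrap cyc)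
        e< : e < 2 + j
        e< = s≤s (≤-trans (m≤m+n e f) (≤-reflexive eq))

  module _ {b j S x} (nc : ∀ b → ¬ HasCyc b (7 + dbl j) S)
    (cyc : IsCyc b (8 + dbl j) x) {y : V} (sy : y ∷ seg x (8 + dbl j) ⊑ S) where

    shift-y : ∀ a → y ∷ seg (x ∘ (_+ a)) (8 + dbl j) ⊑ S
    shift-y a = ⊑-resp (prep y (↭-sym (seg-shift {x = x} (periodic cyc) a))) sy

    tail-⊑ : ∀ {z : ℕ → V} → y ∷ seg z (8 + dbl j) ⊑ S → seg z (8 + dbl j) ⊑ S
    tail-⊑ {z} = ⊑-trans ([ y ] , ++-comm (seg z (8 + dbl j)) [ y ])

    odd-apart : ∀ a t → t < 4 + j → E b y (x a) → ¬ E b y (x (suc (dbl t) + a))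
    odd-apart a zero _ = Structure.not-adjacent nc (cyc-shift cyc a) (tail-⊑ {x ∘ (_+ a)} (shift-y a)) (shift-y a)
    odd-apart a (suc e) (s≤s (s≤s lt)) e₀ e₁ with m≤n⇒m<n∨m≡n lt
    ... | inj₁ (s≤s lt') = let (f , eq) = m≤n⇒∃[o]m+o≡n lt' in
      Structure.not-odd-apart nc (cyc-shift cyc a) (tail-⊑ {x ∘ (_+ a)} (shift-y a)) (shift-y a) e f eq e₀ e₁
    -- At distance `7 + dbl j`, one less than the length, the positions are consecutive across the
    -- end of the period.
    ... | inj₂ refl = Structure.not-adjacent nc (cyc-shift cyc a') (tail-⊑ {x ∘ (_+ a')} (shift-y a')) (shift-y a') e₁
        (subst (E b y) (sym (periodic cyc a)) e₀)
      where a' = 7 + dbl j + a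

    not-both : ∀ p q → p < 4 + j → q < 4 + j → E b y (x (dbl p)) → ¬ E b y (x (suc (dbl q)))
    not-both p q p< q< ep eq with <-≤-connex q p
    ... | inj₂ le with o , refl ← m≤n⇒∃[o]m+o≡n le =
      odd-apart (dbl p) o (≤-trans (s≤s (m≤n+m o p)) q<) ep
          (subst (E b y ∘ x ∘ suc) (trans (dbl-+ p o) (+-comm (dbl p) (dbl o))) eq)
    ... | inj₁ lt with o , refl ← m≤n⇒∃[o]m+o≡n lt =
      odd-apart (suc (dbl q)) o (≤-trans (s≤s (m≤n+m o (suc q))) p<) eq
        (subst (E b y ∘ x) (cong suc (trans (cong suc (trans (dbl-+ q o) (+-comm (dbl q) (dbl o))))
            (sym (+-suc (dbl o) (dbl q))))) ep)

  -- The Ramsey number of an odd cycle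

  interleave : ∀ {b} e es z ys → length ys ≡ suc (length es) → All (λ y → All (E b y) (e ∷ es ++ [ z ])) ys →
    ∃ λ l → Path b e l z × l ↭ (e ∷ es ++ [ z ]) ++ ys
  interleave e [] z (y ∷ []) refl ((p ∷ q ∷ []) ∷ []) = e ∷ y ∷ z ∷ [] , (E-sym p ∷ᵖ q ∷ᵖ [ z ]ᵖ) ,
      prep e (_↭_.swap y z ↭-refl)
  interleave e (e' ∷ es) z (y ∷ ys) eq ((p ∷ q ∷ _) ∷ h)
    with l , P , lp ← interleave e' es z ys (suc-injective eq) (All.map All.tail h) =
    e ∷ y ∷ l , (E-sym p ∷ᵖ q ∷ᵖ P) , prep e (↭-trans (prep y lp) (↭-sym (shift y (e' ∷ es ++ [ z ]) ys)))

  -- The clique vertices alternate with `3 + j` vertices of `ys`; a single clique edge closes the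
  -- cycle and makes its length odd.
  clique-join : ∀ {b j} L ys → Clique b L → 4 + j ≡ length L → 3 + j ≤ length ys → All (λ y → All (E b y) L) ys →
    HasCyc b (7 + dbl j) (L ++ ys)
  clique-join {b} {j} L ys c len le h
    with ys₁ , ys₂ , refl , len₁ ← take-drop (3 + j) ys le
    with (e ∷ z ∷ es) ← L =
    let
      L↭ : e ∷ z ∷ es ↭ e ∷ es ++ [ z ]
      L↭ = prep e (++-comm [ z ] es)
      len-es = suc-injective (suc-injective len)
      (l , P , lp) = interleave e es z ys₁ (trans len₁ (cong suc len-es))
        (All.map (All-resp-↭ L↭) (++⁻ˡ ys₁ h)) in
    subst (λ m → HasCyc b m _)
      (trans (↭-length lp) (trans (length-++ (e ∷ es ++ [ z ]))
          (trans (cong₂ _+_ (trans (sym (↭-length L↭)) (sym len)) len₁)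
        (trans (solveℕ 1 (λ j → (con 4 :+ j) :+ (con 3 :+ j) := con 7 :+ (j :+ j)) refl j)
            (cong (7 +_) (sym (dbl≡+ j)))))))
      (close P (adjacent c (es , _↭_.swap z e ↭-refl))
          (⊑-resp (↭-sym lp) (⊑-++ ([] , ↭-trans (++-identityʳ _) (↭-sym L↭)) (ys₂ , ↭-refl))))

  HasCyc-⊑ : ∀ {b n S T} → S ⊑ T → HasCyc b n S → HasCyc b n T
  HasCyc-⊑ s (x , c , t) = x , c , ⊑-trans t s

  -- A monochromatic cycle with one more vertex comes from `even-ramsey`. At least `5 + dbl j`
  -- vertices lie outside it, each blue to all of `Ev` or to all of `Od`, so `3 + j` of them go with
  -- the same clique.
  odd-ramsey : ∀ j S → 13 + dbl (dbl j) ≤ length S → ¬ (∀ b → ¬ HasCyc b (7 + dbl j) S)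
  odd-ramsey j S large nc = even-ramsey (suc j) S
    (≤-trans (≤-trans (≤-reflexive (solveℕ 2
        (λ j d → con 8 :+ (con 1 :+ j :+ (con 2 :+ d)) := con 11 :+ (j :+ d)) refl j (dbl j)))
       (+-mono-≤ {11} {13} (m≤m+n 11 2)
           (≤-trans (+-monoˡ-≤ (dbl j) (≤-trans (m≤m+n j j) (≤-reflexive (sym (dbl≡+ j)))))
               (≤-reflexive (sym (dbl≡+ (dbl j))))))) large)
    λ b (x , cyc , Y , p) → main b x cyc Y p
    where
    main : ∀ b x → IsCyc b (8 + dbl j) x → ∀ Y → seg x (8 + dbl j) ++ Y ↭ S → ⊥
    main b x cyc Y p with as , bs , sp , pa , pb ← split (λ y → All.all? (E? (not b) y) (seg (x ∘ dbl) (4 + j))) Y =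
      [ (λ le → nc (not b) (HasCyc-⊑ (sub₁ as bs sp)
          (clique-join (seg (x ∘ dbl) (4 + j)) as ev-clique (sym (length-applyUpTo (x ∘ dbl) (4 + j))) le pa)))
      , (λ le → nc (not b) (HasCyc-⊑ (sub₂ as bs sp)
          (clique-join (seg (x ∘ suc ∘ dbl) (4 + j)) bs od-clique (sym (length-applyUpTo (x ∘ suc ∘ dbl) (4 + j))) le
           (All.tabulate λ {y} y∈ → blue-to-odd y (y-⊑ as bs sp y∈) (All.lookup pb y∈))))) ]′
      (pigeonhole (2 + j) (2 + j) {length as} {length bs}
          (≤-trans (+-cancelˡ-≤ (8 + dbl j) _ _ (≤-trans (≤-reflexive count) (≤-trans large
        (≤-reflexive (trans (sym (↭-length p))
            (trans (length-++ (seg x (8 + dbl j))) (cong (_+ length Y) (length-applyUpTo x (8 + dbl j)))))))))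
        (≤-reflexive (trans (sym (↭-length sp)) (length-++ as)))))
      where
      open Structure nc cyc (Y , p)
      open EvenCycle nc cyc (Y , p) using (Ev; Od; Ev++Od)
      count : (8 + dbl j) + suc ((2 + j) + (2 + j)) ≡ 13 + dbl (dbl j)
      count = trans (solveℕ 2 (λ d j → (con 8 :+ d) :+ (con 1 :+ ((con 2 :+ j) :+ (con 2 :+ j))) := con 13 :+
          (d :+ (j :+ j))) refl (dbl j) j)
        (cong (13 +_) (trans (cong (dbl j +_) (sym (dbl≡+ j))) (sym (dbl≡+ (dbl j)))))
      sub₁ : ∀ as bs → as ++ bs ↭ Y → Ev ++ as ⊑ S
      sub₁ as bs sp = Od ++ bs , ↭-trans
          (solve↭ 4 (λ a b c d → ((a ⊕ c) ⊕ (b ⊕ d)) ⊜ ((a ⊕ b) ⊕ (c ⊕ d))) ↭-refl Ev Od as bs)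
              (↭-trans (++⁺ Ev++Od sp) p)
      sub₂ : ∀ as bs → as ++ bs ↭ Y → Od ++ bs ⊑ S
      sub₂ as bs sp = Ev ++ as , ↭-trans
          (solve↭ 4 (λ a b c d → ((b ⊕ d) ⊕ (a ⊕ c)) ⊜ ((a ⊕ b) ⊕ (c ⊕ d))) ↭-refl Ev Od as bs)
              (↭-trans (++⁺ Ev++Od sp) p)
      y-⊑ : ∀ as bs → as ++ bs ↭ Y → ∀ {y} → y ∈ bs → y ∷ seg x (8 + dbl j) ⊑ S
      y-⊑ as bs sp y∈ with ys , zs , refl ← ∈-∃++ y∈ = as ++ ys ++ zs ,
        ↭-trans (solve↭ 5 (λ y x a b c → ((y ⊕ x) ⊕ (a ⊕ b ⊕ c)) ⊜ (x ⊕ (a ⊕ (b ⊕ y ⊕ c)))) ↭-refl [ _ ]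
            (seg x (8 + dbl j)) as ys zs) (↭-trans (++⁺ˡ (seg x (8 + dbl j)) sp) p)
      blue-to-odd : ∀ y → y ∷ seg x (8 + dbl j) ⊑ S → ¬ All (E (not b) y) Ev → All (E (not b) y) Od
      blue-to-odd y sy na = applyUpTo⁺₁ (x ∘ suc ∘ dbl) (4 + j) λ {q} q< → ¬E λ red →
        na (applyUpTo⁺₁ (x ∘ dbl) (4 + j) λ {p'} p< → ¬E λ red' → not-both nc cyc sy p' q p< q< red' red)

  -- Cycles from large degrees, after Dirac and Bondy

  seg-path-below : ∀ {b} x n → (∀ i → i < n → E b (x i) (x (suc i))) → Path b (x 0) (seg x (suc n)) (x n)
  seg-path-below x zero e = [ x 0 ]ᵖ
  seg-path-below x (suc n) e = e 0 z<s ∷ᵖ seg-path-below (x ∘ suc) n (λ i → e (suc i) ∘ s<s)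

  path-edges : ∀ {b a z} x n → Path b a (seg x (suc n)) z → a ≡ x 0 × z ≡ x n × (∀ i → i < n → E b (x i) (x (suc i)))
  path-edges x zero [ _ ]ᵖ = refl , refl , λ _ ()
  path-edges x (suc n) (e ∷ᵖ p) with refl , eq , h ← path-edges (x ∘ suc) n p =
    refl , eq , λ { zero _ → e ; (suc i) (s≤s lt) → h i lt }

  path-length : ∀ {b a l z} → Path b a l z → ∃ λ n → length l ≡ suc n
  path-length [ _ ]ᵖ = 0 , refl
  path-length (_ ∷ᵖ p) = _ , refl

  module _ (b : Bool) (A : List V) (R t : ℕ) (size : length A ≤ suc (R + R)) (t< : 3 + t ≤ R)
    (degree : ∀ {u r} → u ∷ r ↭ A → suc R ≤ cnt (E? b u) r) (nc : ¬ HasCyc b (3 + t) A) where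

    NoPath : ℕ → Set
    NoPath p = ∀ {a l z} → Path b a l z → l ⊑ A → length l ≡ p → ⊥

    inner-degree : ∀ {u l r} → (u ∷ l) ++ r ↭ A → (∀ {v} → v ∈ r → ¬ E b u v) → suc R ≤ cnt (E? b u) l
    inner-degree {u} {l} {r} p h = ≤-trans (degree p) (≤-reflexive (trans (cnt-++ (E? b u) l r)
      (trans (cong (cnt (E? b u) l +_) (cnt-none (E? b u) r h)) (+-identityʳ _))))

    extend-⊑ : ∀ {l r v} → l ++ r ↭ A → v ∈ r → v ∷ l ⊑ A
    extend-⊑ {l} {r} {v} p v∈ with as , bs , refl ← ∈-∃++ v∈ = as ++ bs ,
      ↭-trans (solve↭ 4 (λ v l a b → ((v ⊕ l) ⊕ (a ⊕ b)) ⊜ (l ⊕ (a ⊕ v ⊕ b))) ↭-refl [ v ] l as bs) p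

    -- Bondy's count. A neighbour of the cycle outside it would give a path with one vertex more, so
    -- `x 0` and `x 1` each have at least `R` neighbours among the other `q` cycle vertices. Pairing
    -- the chords at `x 0` with those at `x 1` that would complete a cycle of length `3 + t` bounds
    -- the sum by `q`, which is less than `R + R`.
    pancyclic : ∀ {x} g → NoPath (suc (2 + (t + g))) → IsCyc b (2 + (t + g)) x → seg x (2 + (t + g)) ⊑ A → 0 < g → ⊥
    pancyclic {x} (suc g) np cyc s _ = <⇒≱ small (≤-trans (+-mono-≤ deg₀ deg₁)
        (≤-trans (≤-reflexive (trans (cong₂ _+_ split₀ split₁)
            (ring (cnt (E? b (x 0)) (seg z t)) (cnt (E? b (x 0)) (seg (z ∘ (t +_)) (suc g)))
                (cnt (E? b (x 1)) (seg z (suc g))) (cnt (E? b (x 1)) (seg (z ∘ (suc g +_)) t)))))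
          (+-mono-≤ (cnt-disjoint (E? b (x 0)) (E? b (x 1)) (z ∘ (t +_)) z (suc g) near-chords)
            (cnt-disjoint (E? b (x 0)) (E? b (x 1)) z (z ∘ (suc g +_)) t far-chords))))
      where
      q = t + suc g
      p = 2 + q
      z = x ∘ (2 +_)
      ring : ∀ a b c d → (a + b) + (c + d) ≡ (b + c) + (a + d)
      ring = solveℕ 4 (λ a b c d → (a :+ b) :+ (c :+ d) := (b :+ c) :+ (a :+ d)) refl
      small : suc g + t < R + R
      small = ≤-trans (≤-reflexive (solveℕ 2
          (λ t g → con 1 :+ (con 1 :+ g :+ t) := con 1 :+ (t :+ (con 1 :+ g))) refl t g))
        (s≤s⁻¹ (≤-trans (≤-trans (≤-reflexive (sym (length-applyUpTo x p))) (⊑-length s)) size))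
      vertex-degree : ∀ i → suc R ≤ cnt (E? b (x i)) (seg (x ∘ suc ∘ (_+ i)) (suc q))
      vertex-degree i with r , pr ← ⊑-shift cyc s i = inner-degree pr λ v∈ e →
        np (E-sym e ∷ᵖ seg-path (x ∘ (_+ i)) (edge (cyc-shift cyc i)) (suc q)) (extend-⊑ pr v∈)
            (cong suc (length-applyUpTo (x ∘ (_+ i)) p))
      deg₀ : R ≤ cnt (E? b (x 0)) (seg z q)
      deg₀ = s≤s⁻¹ (≤-trans (vertex-degree 0)
          (≤-trans (≤-reflexive (cong (cnt (E? b (x 0))) (seg-cong (λ i → cong (x ∘ suc) (+-identityʳ i)) (suc q))))
        (+-monoˡ-≤ _ (bit≤1 (E? b (x 0) (x 1))))))
      deg₁ : R ≤ cnt (E? b (x 1)) (seg z q)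
      deg₁ = +-cancelʳ-≤ 1 R _ (≤-trans (≤-reflexive (+-comm R 1)) (≤-trans (vertex-degree 1)
        (≤-trans (≤-reflexive (trans (cong (cnt (E? b (x 1)))
            (trans (seg-cong (λ i → cong (x ∘ suc) (+-comm i 1)) (suc q)) (sym (applyUpTo-∷ʳ z q))))
          (cnt-++ (E? b (x 1)) (seg z q) [ z q ])))
          (+-monoʳ-≤ (cnt (E? b (x 1)) (seg z q)) (≤-trans (≤-reflexive (+-identityʳ _)) (bit≤1 (E? b (x 1) (z q))))))))
      split₀ : cnt (E? b (x 0)) (seg z q) ≡ cnt (E? b (x 0)) (seg z t) + cnt (E? b (x 0)) (seg (z ∘ (t +_)) (suc g))
      split₀ = trans (cong (cnt (E? b (x 0))) (seg-+ z t (suc g))) (cnt-++ (E? b (x 0)) (seg z t) _)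
      split₁ : cnt (E? b (x 1)) (seg z q) ≡ cnt (E? b (x 1)) (seg z (suc g)) + cnt (E? b (x 1)) (seg (z ∘ (suc g +_)) t)
      split₁ = trans (cong (cnt (E? b (x 1))) (trans (cong (seg z) (+-comm t (suc g))) (seg-+ z (suc g) t)))
          (cnt-++ (E? b (x 1)) (seg z (suc g)) _)
      -- the cycle x₁, x₂₊ᵢ, …, x₂₊ₜ₊ᵢ, x₀
      near-chords : ∀ i → i < suc g → E b (x 0) (z (t + i)) → ¬ E b (x 1) (z i)
      near-chords i (s≤s le) e₀ e₁ with f , refl ← m≤n⇒∃[o]m+o≡n le = nc (subst (λ m → HasCyc b m A) len
        (close (e₁ ∷ᵖ join (seg-path-at cyc (2 + i) t) (E-sym (subst (E b (x 0) ∘ x) (cong (2 +_) (+-comm t i)) e₀))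
            [ x 0 ]ᵖ) (edge cyc 0)
          (⊑-trans (seg z i ++ seg (z ∘ (i +_) ∘ (suc t +_)) f ,
            ↭-trans (solve↭ 5 (λ a b c d e → ((a ⊕ (b ⊕ c)) ⊕ (d ⊕ e)) ⊜ (c ⊕ a ⊕ (d ⊕ (b ⊕ e)))) ↭-refl [ x 1 ]
                (seg (x ∘ (2 + i +_)) (suc t)) [ x 0 ] (seg z i) (seg (z ∘ (i +_) ∘ (suc t +_)) f))
              (↭-reflexive (cong (λ l → x 0 ∷ x 1 ∷ l) (trans (cong (seg z i ++_) (sym (seg-+ (z ∘ (i +_)) (suc t) f)))
                (trans (sym (seg-+ z i (suc t + f)))
                    (cong (seg z) (solveℕ 3 (λ i t f → i :+ (con 1 :+ t :+ f) := t :+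
                        (con 1 :+ (i :+ f))) refl i t f))))))) s)))
        where
        len : length (x 1 ∷ seg (x ∘ (2 + i +_)) (suc t) ++ [ x 0 ]) ≡ 3 + t
        len = cong suc (trans (length-++ (seg (x ∘ (2 + i +_)) (suc t)))
            (trans (cong (_+ 1) (length-applyUpTo (x ∘ (2 + i +_)) (suc t))) (+-comm (suc t) 1)))
      -- with a = 3 + i + g, the cycle xₐ, …, xₚ₋₁, x₀, x₂₊ᵢ, …, x₂, x₁
      far-chords : ∀ i → i < t → E b (x 0) (z i) → ¬ E b (x 1) (z (suc g + i))
      far-chords i lt e₀ e₁ with f , eqt ← m≤n⇒∃[o]m+o≡n lt = nc (subst (λ m → HasCyc b m A) (len f eqt)
        (close (join (seg-path-at cyc a (suc f)) (subst (λ v → E b v (z i)) (sym (end f eqt)) e₀)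
            (reverseᵖ (seg-path (x ∘ suc) (edge cyc ∘ suc) (suc i))))
          (subst (E b (x 1) ∘ x) (cong (2 +_) (+-comm (suc g) i)) e₁)
          (⊑-resp (++⁺ˡ (seg (x ∘ (a +_)) (2 + f)) (↭-sym (↭-reverse (seg (x ∘ suc) (2 + i)))))
            (⊑-trans (seg (x ∘ suc ∘ (2 + i +_)) g ,
              ↭-trans (solve↭ 3 (λ a b c → ((a ⊕ b) ⊕ c) ⊜ (b ⊕ (c ⊕ a))) ↭-refl (seg (x ∘ (a +_)) (2 + f))
                  (seg (x ∘ suc) (2 + i)) (seg (x ∘ suc ∘ (2 + i +_)) g))
              (↭-trans (↭-reflexive (trans (cong (λ l → seg (x ∘ suc) (2 + i) ++ (seg (x ∘ suc ∘ (2 + i +_)) g ++ l))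
                  (seg-cong (λ h → cong x (reindex h)) (2 + f)))
                (trans (cong (seg (x ∘ suc) (2 + i) ++_) (sym (seg-+ (x ∘ suc ∘ (2 + i +_)) g (2 + f))))
                  (trans (sym (seg-+ (x ∘ suc) (2 + i) (g + (2 + f)))) (cong (seg (x ∘ suc)) (total f eqt))))))
              (seg-rotate x p (cyc-wrap cyc)))) s))))
        where
        a = 2 + (i + suc g)
        reindex : ∀ h → a + h ≡ suc ((2 + i) + (g + h))
        reindex h = solveℕ 3 (λ i g h → (con 2 :+ (i :+ (con 1 :+ g))) :+ h := con 1 :+
            ((con 2 :+ i) :+ (g :+ h))) refl i g h
        total : ∀ f → suc i + f ≡ t → (2 + i) + (g + (2 + f)) ≡ p
        total f eqt = trans (solveℕ 3 (λ i g f → (con 2 :+ i) :+ (g :+ (con 2 :+ f)) := con 2 :+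
            ((con 1 :+ i :+ f) :+ (con 1 :+ g))) refl i g f)
          (cong (λ t → 2 + (t + suc g)) eqt)
        end : ∀ f → suc i + f ≡ t → x (a + suc f) ≡ x 0
        end f eqt = trans (cong x (trans
            (solveℕ 3 (λ i g f → (con 2 :+ (i :+ (con 1 :+ g))) :+ (con 1 :+ f) := (con 2 :+ i) :+
                (g :+ (con 2 :+ f))) refl i g f) (total f eqt))) (cyc-wrap cyc)
        len : ∀ f → suc i + f ≡ t → length (seg (x ∘ (a +_)) (2 + f) ++ reverse (seg (x ∘ suc) (2 + i))) ≡ 3 + t
        len f eqt = trans (length-++ (seg (x ∘ (a +_)) (2 + f)))
            (trans (cong₂ _+_ (length-applyUpTo (x ∘ (a +_)) (2 + f))
                (trans (length-reverse (seg (x ∘ suc) (2 + i))) (length-applyUpTo (x ∘ suc) (2 + i))))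
          (trans (solveℕ 2 (λ i f → (con 2 :+ f) :+ (con 2 :+ i) := con 3 :+ (con 1 :+ i :+ f)) refl i f)
              (cong (3 +_) eqt)))

    -- Dirac's argument. Since no path has one vertex more, both ends have all their neighbours on
    -- this one. Their degrees add up to more than `p`, so some `x (suc i)` is joined to `x 0` while
    -- `x i` is joined to `x p`; this closes a cycle on all vertices of the path, which `pancyclic`
    -- refutes.
    path-step : ∀ p x r → NoPath (2 + p) → (∀ i → i < p → E b (x i) (x (suc i))) → seg x (suc p) ++ r ↭ A → ⊥
    path-step p x r np e pr = <⇒≱ (≤-trans (s≤s (n≤1+n _))
        (≤-trans (≤-reflexive (cong suc (sym (+-suc R R)))) (+-mono-≤ deg₀ deg₁)))
        (≤-trans (cnt-disjoint (E? b (x 0)) (E? b (x p)) (x ∘ suc) x p chords)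
          (s≤s⁻¹ (≤-trans (≤-trans (≤-reflexive (sym (length-applyUpTo x (suc p)))) (⊑-length (r , pr))) size)))
      where
      P : Path b (x 0) (seg x (suc p)) (x p)
      P = seg-path-below x p e
      deg₀ : suc R ≤ cnt (E? b (x 0)) (seg (x ∘ suc) p)
      deg₀ = inner-degree pr λ v∈ f → np (E-sym f ∷ᵖ P) (extend-⊑ pr v∈) (cong suc (length-applyUpTo x (suc p)))
      deg₁ : suc R ≤ cnt (E? b (x p)) (seg x p)
      deg₁ = inner-degree (↭-trans (++⁺ʳ r
          (↭-trans (∷↭∷ʳ (x p) (seg x p)) (↭-reflexive (applyUpTo-∷ʳ x p)))) pr) λ v∈ f →
        np (E-sym f ∷ᵖ reverseᵖ P) (⊑-resp (prep _ (↭-sym (↭-reverse (seg x (suc p))))) (extend-⊑ pr v∈))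
          (cong suc (trans (length-reverse (seg x (suc p))) (length-applyUpTo x (suc p))))
      cycle : ∀ {y} → IsCyc b (suc p) y → seg y (suc p) ⊑ A → ⊥
      cycle {y} cyc s with o , eq ← m≤n⇒∃[o]m+o≡n (≤-trans (≤-trans (n≤1+n _) t<) (≤-trans (n≤1+n R)
          (≤-trans deg₀ (≤-trans (cnt≤length (E? b (x 0)) (seg (x ∘ suc) p))
              (≤-reflexive (length-applyUpTo (x ∘ suc) p)))))) =
        pancyclic {y} (suc o) (subst (NoPath ∘ suc) eq' np) (subst (λ m → IsCyc b m y) eq' cyc)
            (subst (λ m → seg y m ⊑ A) eq' s) z<s
        where
        eq' : suc p ≡ 2 + (t + suc o)
        eq' = trans (cong suc (sym eq)) (cong (2 +_) (sym (+-suc t o)))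
      chords : ∀ i → i < p → E b (x 0) (x (suc i)) → ¬ E b (x p) (x i)
      chords i lt f g with o , eq ← m≤n⇒∃[o]m+o≡n lt =
        -- The cycle i + 1, ..., p, i, ..., 0.
        let (y , cyc , s) = close-in {n = suc p} [] (join
                (subst₂ (λ u v → Path b u (seg (x ∘ (suc i +_)) (suc o)) v) (cong x (+-identityʳ (suc i))) (cong x eq)
                  (seg-path-below (x ∘ (suc i +_)) o λ h h< → subst (E b (x (suc i + h)) ∘ x) (sym (+-suc (suc i) h))
                    (e (suc i + h) (≤-trans (≤-reflexive (sym (+-suc (suc i) h)))
                        (≤-trans (+-monoʳ-≤ (suc i) h<) (≤-reflexive eq))))))
                g (reverseᵖ (seg-path-below x i λ h h< → e h (<-trans h< lt))))
              f
              (↭-trans (++-identityʳ _) (↭-trans (++⁺ˡ (seg (x ∘ (suc i +_)) (suc o)) (↭-reverse (seg x (suc i))))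
                (↭-trans (++-comm (seg (x ∘ (suc i +_)) (suc o)) (seg x (suc i)))
                  (↭-reflexive (trans (sym (seg-+ x (suc i) (suc o)))
                      (cong (seg x) (trans (+-suc (suc i) o) (cong suc eq))))))))
              (sym (length-applyUpTo x (suc p)))
              (r , pr)
        in cycle cyc s

    -- Downward induction on `n`, starting from paths that would need more vertices than `A` has.
    no-path : ∀ d n → n + d ≡ suc (length A) → NoPath n
    no-path zero n eq P s len = <⇒≱ (≤-reflexive (trans (sym eq) (trans (+-identityʳ n) (sym len)))) (⊑-length s)
    no-path (suc d) n eq {a} {l} P (r , pr) len with p , lp ← path-length P =
      path-step p x r (subst (NoPath ∘ suc) (trans (sym len) lp) (no-path d (suc n) (trans (sym (+-suc n d)) eq)))
        (proj₂ (proj₂ (path-edges x p (subst (λ q → Path b a q _) (sym seg-x) P))))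
        (subst (λ q → q ++ r ↭ A) (sym seg-x) pr)
      where
      x = stream a l
      seg-x : seg x (suc p) ≡ l
      seg-x = trans (cong (seg x) (sym lp)) (seg-of-stream a l)

    dirac : ¬ 0 < length A
    dirac lt with (a ∷ []) , refl , s ← ⊑-extend {L = []} 1 (A , ↭-refl) lt = no-path (length A) 1 refl [ a ]ᵖ s refl

  -- From cycles to wheels

  HasWheel : Bool → ℕ → List V → Set
  HasWheel b m S = ∃ λ v → ∃ λ L → All (E b v) L × v ∷ L ⊑ S × HasCyc b m L

  module _ (t R : ℕ) (t≤R : 3 + t ≤ R) (ramsey : ∀ S → R ≤ length S → ¬ (∀ b → ¬ HasCyc b (3 + t) S)) where

    module _ {b v A S} (hub : All (E b v) A) (sub : v ∷ A ⊑ S) (nw : ∀ b → ¬ HasWheel b (3 + t) S) where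

      -- A monochromatic rim exists inside `r`: in colour `b` its hub is `v`, in the other colour it
      -- is `u`.
      no-blue-degree : ∀ {u} r → r ⊑ A → u ∷ r ⊑ S → All (¬_ ∘ E b u) r → ¬ R ≤ length r
      no-blue-degree {u} r (r' , p) s blue le = ramsey r le λ b' c → case b' ≟ᵇ b of λ where
        (yes refl) → nw b (v , A , hub , sub , HasCyc-⊑ (r' , p) c)
        (no ne) → nw b' (u , r , All.map (λ ne' → trans (¬-not ne') (sym (¬-not ne))) blue , s , c)

      -- Of the `R + R` other vertices of `A`, fewer than `R` are joined to `u` in the other colour,
      -- by `no-blue-degree`.
      degree : length A ≡ suc (R + R) → ∀ {u r} → u ∷ r ↭ A → suc R ≤ cnt (E? b u) r
      degree len {u} {r} p with as , bs , q , pa , pb ← split (E? b u) r =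
        [ (λ le → ≤-trans le (≤-trans (≤-reflexive (sym (cnt-all (E? b u) pa)))
            (≤-trans (m≤m+n _ (cnt (E? b u) bs))
                (≤-reflexive (trans (sym (cnt-++ (E? b u) as bs)) (cnt-↭ (E? b u) q))))))
        , (λ le → ⊥-elim (no-blue-degree bs
            (u ∷ as , ↭-trans (++-comm bs (u ∷ as)) (↭-trans (prep u q) p))
            (⊑-trans {l = u ∷ bs} (as , ↭-trans (prep u (↭-trans (++-comm bs as) q)) p)
                (⊑-trans ([ v ] , ++-comm A [ v ]) sub))
            pb (subst (_≤ length bs) (suc-pred R) le))) ]′
        (pigeonhole R (pred R) {length as} {length bs} (≤-reflexive (trans (sym (+-suc R (pred R)))
          (trans (cong (R +_) (suc-pred R))
              (trans (suc-injective (trans (sym len) (sym (↭-length p)))) (trans (sym (↭-length q)) (length-++ as)))))))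
        where instance _ = >-nonZero (≤-trans (s≤s z≤n) t≤R)

      no-big-neighbourhood : length A ≡ suc (R + R) → ⊥
      no-big-neighbourhood len = dirac b A R t (≤-reflexive len) t≤R (degree len)
        (λ c → nw b (v , A , hub , sub , c)) (≤-trans (s≤s z≤n) (≤-reflexive (sym len)))

    no-neighbourhood : ∀ {b v S} L → All (E b v) L → v ∷ L ⊑ S → (∀ b → ¬ HasWheel b (3 + t) S) →
      ¬ suc (R + R) ≤ length L
    no-neighbourhood {v = v} L hub sub nw le with as , bs , refl , len ← take-drop (suc (R + R)) L le =
      no-big-neighbourhood (++⁻ˡ as hub) (⊑-prefix (v ∷ as) bs sub) nw len

    -- Of the at least 4R + 1 edges at the first vertex, 2R + 1 have the same colour.
    wheel-ramsey : ∀ S → 2 + ((R + R) + (R + R)) ≤ length S → ¬ (∀ b → ¬ HasWheel b (3 + t) S)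
    wheel-ramsey (v ∷ S) (s≤s le) nw with as , bs , p , pa , pb ← split (E? true v) S =
      [ no-neighbourhood as pa (bs , prep v p) nw
      , no-neighbourhood bs (All.map ¬E pb) (as , prep v (↭-trans (++-comm bs as) p)) nw ]′
      (pigeonhole (R + R) (R + R) (≤-trans le (≤-reflexive (trans (sym (↭-length p)) (length-++ as)))))

-- Wheels as injective copies

-- Here positions become vertices again, because `allFin` has no repetitions.
unique-pair : ∀ {N} {u v : Fin N} → u ∷ v ∷ [] ⊑ allFin N → u ≢ v
unique-pair {N} (r , p) = All.head (AllPairs.head (AllPairs-resp-↭ (setoid (Fin N)) (λ ne e → ne (sym e))
  ((λ { refl ne → ne }) , (λ { refl ne → ne })) (↭⇒↭ₛ (↭-sym p)) (allFin⁺ N)))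

module _ {N : ℕ} (col : Colouring N) (col-sym : SymmetricColouring col) where
  open Colour col col-sym

  wheel-copy : ∀ {b m} → HasWheel b m (allFin N) → MonoCopy (Wheel (suc m)) col b
  wheel-copy {b} {m} (v , L , hub , sub , x , cyc , s) = z ∘ toℕ , (λ {i} {j} → inj i j) , adj
    where
    z : ℕ → Fin N
    z zero = v
    z (suc i) = x i
    z-⊑ : seg z (suc m) ⊑ allFin N
    z-⊑ = ⊑-trans (proj₁ s , prep v (proj₂ s)) sub
    inj : ∀ (i j : Fin (suc m)) → z (toℕ i) ≡ z (toℕ j) → i ≡ j
    inj i j e with <-cmp (toℕ i) (toℕ j)
    ... | tri< lt _ _ = ⊥-elim (unique-pair (⊑-trans (seg-pair z lt (toℕ<n j)) z-⊑) e)
    ... | tri≈ _ eq _ = toℕ-injective eq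
    ... | tri> _ _ gt = ⊥-elim (unique-pair (⊑-trans (seg-pair z gt (toℕ<n i)) z-⊑) (sym e))
    spoke : ∀ (i : Fin m) → E b v (x (toℕ i))
    spoke i = All.lookup hub (∈-resp-↭ (proj₂ s) (∈-++⁺ˡ (∈-applyUpTo⁺ x (toℕ<n i))))
    rim : ∀ (i j : Fin m) → CycAdj m i j → E b (x (toℕ i)) (x (toℕ j))
    rim i j (inj₁ e) = subst (E b (x (toℕ i)) ∘ x) (sym e) (edge cyc (toℕ i))
    rim i j (inj₂ (inj₁ e)) = E-sym (subst (E b (x (toℕ j)) ∘ x) (sym e) (edge cyc (toℕ j)))
    rim i j (inj₂ (inj₂ (inj₁ (e , f)))) = E-sym
        (subst (E b (x (toℕ j))) (trans (cong x f) (trans (cyc-wrap cyc) (cong x (sym e)))) (edge cyc (toℕ j)))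
    rim i j (inj₂ (inj₂ (inj₂ (e , f)))) = subst (E b (x (toℕ i)))
        (trans (cong x f) (trans (cyc-wrap cyc) (cong x (sym e)))) (edge cyc (toℕ i))
    adj : ∀ u w → WheelAdj m u w → E b (z (toℕ u)) (z (toℕ w))
    adj fz (fs j) _ = spoke j
    adj (fs i) fz _ = E-sym (spoke i)
    adj (fs i) (fs j) a = rim i j a

-- Decidability by finite search

-- Only predicates respecting `_≈_` are searched. For functions this relation is pointwise equality,
-- so that a function may be replaced by one rebuilt from its values.
Searchable : (A : Set) → (A → A → Set) → Set₁
Searchable A _≈_ = (P : A → Set) → (∀ {a a'} → a ≈ a' → P a → P a') → (∀ a → Dec (P a)) → Dec (∃ P)

search-Fin : ∀ n → Searchable (Fin n) _≡_
search-Fin n P _ P? = any? P?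

search-Bool : Searchable Bool _≡_
search-Bool P _ P? with P? true | P? false
... | yes p | _ = yes (true , p)
... | no _ | yes p = yes (false , p)
... | no p | no q = no λ { (true , r) → p r ; (false , r) → q r }

search-→ : ∀ {A _≈_} → (∀ a → a ≈ a) → Searchable A _≈_ → ∀ n → Searchable (Fin n → A) (λ f g → ∀ i → f i ≈ g i)
search-→ rfl sA zero P resp P? with P? (λ ())
... | yes p = yes (_ , p)
... | no p = no λ (f , q) → p (resp (λ ()) q)
search-→ {A} {_≈_} rfl sA (suc n) P resp P? = map′ (λ (a , g , p) → cons a g , p)
    (λ (f , p) → f fz , f ∘ fs , resp (λ { fz → rfl _ ; (fs i) → rfl _ }) p)
  (sA (λ a → ∃ λ g → P (cons a g)) (λ e (g , p) → g , resp (λ { fz → e ; (fs i) → rfl _ }) p)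
    (λ a → search-→ {A} {_≈_} rfl sA n (λ g → P (cons a g)) (λ e → resp (λ { fz → rfl _ ; (fs i) → e i }))
        (λ g → P? (cons a g))))
  where
  cons : A → (Fin n → A) → Fin (suc n) → A
  cons a g fz = a
  cons a g (fs i) = g i

CycAdj? : ∀ m i j → Dec (CycAdj m i j)
CycAdj? m i j = (toℕ j ≟ suc (toℕ i)) ⊎-dec (toℕ i ≟ suc (toℕ j)) ⊎-dec
  (((toℕ i ≟ 0) ×-dec (suc (toℕ j) ≟ m)) ⊎-dec ((toℕ j ≟ 0) ×-dec (suc (toℕ i) ≟ m)))

Wheel-Adj? : ∀ n u v → Dec (Adj (Wheel n) u v)
Wheel-Adj? (suc m) fz fz = no λ ()
Wheel-Adj? (suc m) fz (fs j) = yes tt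
Wheel-Adj? (suc m) (fs i) fz = yes tt
Wheel-Adj? (suc m) (fs i) (fs j) = CycAdj? m i j

module _ (G : Graph) (Adj? : ∀ u v → Dec (Adj G u v)) where

  MonoCopy? : ∀ {N} (c : Colouring N) b → Dec (MonoCopy G c b)
  MonoCopy? {N} c b = search-→ {_≈_ = _≡_} (λ _ → refl) (search-Fin N) (order G) _
    (λ {f} {g} e (inj , h) → (λ {u} {v} p → inj (trans (e u) (trans p (sym (e v))))) ,
      λ u v a → trans (sym (cong₂ c (e u) (e v))) (h u v a))
    (λ f → map′ (λ h {u} {v} → h u v) (λ h u v → h {u} {v}) (all? λ u → all? λ v → (f u ≟ᶠ f v) →-dec (u ≟ᶠ v))
      ×-dec (all? λ u → all? λ v → Adj? u v →-dec (c (f u) (f v) ≟ᵇ b)))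

  MonoCopy-cong : ∀ {N} {c c' : Colouring N} {b} → (∀ i j → c i j ≡ c' i j) → MonoCopy G c b → MonoCopy G c' b
  MonoCopy-cong e (f , inj , h) = f , inj , λ u v a → trans (sym (e _ _)) (h u v a)

  -- The search is for a counterexample: a symmetric colouring without a monochromatic copy.
  Arrows? : ∀ N → Dec (Arrows N G G)
  Arrows? N = map′
    (λ none c cs → decidable-stable (copy? c) λ nc → none (c , cs , nc))
    (λ arr (c , cs , nc) → nc (arr c cs))
    (¬? (search-→ {_≈_ = λ f g → ∀ i → f i ≡ g i} (λ _ _ → refl) (search-→ {_≈_ = _≡_} (λ _ → refl) search-Bool N) N
      (λ c → SymmetricColouring c × ¬ (MonoCopy G c true ⊎ MonoCopy G c false))
      (λ {c} {c'} e (cs , nc) → (λ i j → trans (sym (e i j)) (trans (cs i j) (e j i))) ,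
        λ { (inj₁ m) → nc (inj₁ (MonoCopy-cong (λ i j → sym (e i j)) m))
          ; (inj₂ m) → nc (inj₂ (MonoCopy-cong (λ i j → sym (e i j)) m)) })
      (λ c → all? (λ i → all? λ j → c i j ≟ᵇ c j i) ×-dec ¬? (copy? c))))
    where
    copy? : (c : Colouring N) → Dec (MonoCopy G c true ⊎ MonoCopy G c false)
    copy? c = MonoCopy? c true ⊎-dec MonoCopy? c false

least : (P : ℕ → Set) → (∀ n → Dec (P n)) → ∀ U → P U → ∃ λ R → P R × (∀ M → P M → R ≤ M)
least P P? zero p = 0 , p , λ _ _ → z≤n
least P P? (suc U) p with P? 0
... | yes q = 0 , q , λ _ _ → z≤n
... | no q with R , r , h ← least (P ∘ suc) (P? ∘ suc) U p = suc R , r ,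
    λ { zero m → ⊥-elim (q m) ; (suc M) m → s≤s (h M m) }

-- Cycles and wheels are only shown not to be absent; since copies can be searched for, one exists.
arrows : ∀ t R → 3 + t ≤ R →
  (∀ {V : Set} (col : V → V → Bool) (col-sym : ∀ x y → col x y ≡ col y x) →
    ∀ S → R ≤ length S → ¬ (∀ b → ¬ Colour.HasCyc col col-sym b (3 + t) S)) →
  Arrows (2 + ((R + R) + (R + R))) (Wheel (4 + t)) (Wheel (4 + t))
arrows t R t≤R ramsey c cs = decidable-stable (MonoCopy? W W? c true ⊎-dec MonoCopy? W W? c false) λ nc →
  Colour.wheel-ramsey c cs t R t≤R (ramsey c cs) (allFin _) (≤-reflexive (sym (length-tabulate id)))
    λ { true w → nc (inj₁ (wheel-copy c cs w)) ; false w → nc (inj₂ (wheel-copy c cs w)) }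
  where
  W = Wheel (4 + t)
  W? = Wheel-Adj? (4 + t)

-- Lower bounds from disjoint red cliques

module Blocks (q m M : ℕ) (M≤ : M ≤ q * m) where

  block : Fin M → Fin q
  block i = proj₁ (remQuot {q} m (inject≤ i M≤))

  place : Fin M → Fin m
  place i = proj₂ (remQuot {q} m (inject≤ i M≤))

  colour : Colouring M
  colour i j = does (block i ≟ᶠ block j)

  colour-sym : SymmetricColouring colour
  colour-sym i j with block i ≟ᶠ block j | block j ≟ᶠ block i
  ... | yes _ | yes _ = refl
  ... | no _ | no _ = refl
  ... | yes e | no ne = ⊥-elim (ne (sym e))
  ... | no ne | yes e = ⊥-elim (ne (sym e))

  red : ∀ i j → colour i j ≡ true → block i ≡ block j
  red i j e with block i ≟ᶠ block j
  ... | yes p = p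

  blue : ∀ i j → colour i j ≡ false → block i ≢ block j
  blue i j e with block i ≟ᶠ block j
  ... | no p = p

  block-place-injective : ∀ {i j} → block i ≡ block j → place i ≡ place j → i ≡ j
  block-place-injective {i} {j} e f = inject≤-injective M≤ M≤ i j
    (trans (sym (combine-remQuot {q} m (inject≤ i M≤)))
        (trans (cong₂ combine e f) (combine-remQuot {q} m (inject≤ j M≤))))

  -- A red wheel lies in the block of its hub, where `suc m` vertices would share `m` places.
  no-red : ¬ MonoCopy (Wheel (suc m)) colour true
  no-red (f , inj , h) with i , j , i<j , e ← Fin-pigeonhole ≤-refl (place ∘ f) =
    <-irrefl (cong toℕ (inj (block-place-injective (trans (same i) (sym (same j))) e))) i<j
    where
    same : ∀ i → block (f i) ≡ block (f fz)
    same fz = refl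
    same (fs i) = red _ _ (h (fs i) fz tt)

-- With `h` the block of the hub, a blue rim has only two blocks left and must alternate between
-- them.
Fin3-return : ∀ (h a b c : Fin 3) → a ≢ h → b ≢ h → c ≢ h → a ≢ b → b ≢ c → a ≡ c
Fin3-return = toWitness {a? = all? λ h → all? λ a → all? λ b → all? λ c →
  ¬? (a ≟ᶠ h) →-dec ¬? (b ≟ᶠ h) →-dec ¬? (c ≟ᶠ h) →-dec ¬? (a ≟ᶠ b) →-dec ¬? (b ≟ᶠ c) →-dec (a ≟ᶠ c)} tt

Fin2-repeat : ∀ (a b c : Fin 2) → a ≢ b → a ≢ c → b ≡ c
Fin2-repeat = toWitness {a? = all? λ a → all? λ b → all? λ c → ¬? (a ≟ᶠ b) →-dec ¬? (a ≟ᶠ c) →-dec (b ≟ᶠ c)} tt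

-- The hub and two consecutive rim vertices of a blue wheel would lie in three different blocks.
two-cliques : ∀ n → 3 ≤ n → ∀ M → Arrows M (Wheel n) (Wheel n) → 2 * n ∸ 2 ≤ M
two-cliques (suc zero) (s≤s ())
two-cliques (suc (suc zero)) (s≤s (s≤s ()))
two-cliques (suc m@(suc (suc _))) _ M arr with M ≤? 2 * m
... | no gt = ≤-trans (≤-reflexive (trans (cong (_∸ 2) (*-suc 2 m)) (m+n∸m≡n 2 (2 * m)))) (<⇒≤ (≰⇒> gt))
... | yes M≤ with arr (Blocks.colour 2 m M M≤) (Blocks.colour-sym 2 m M M≤)
...   | inj₁ copy = ⊥-elim (Blocks.no-red 2 m M M≤ copy)
...   | inj₂ (f , _ , h) =
  ⊥-elim (blue (f (fs fz)) (f (fs (fs fz))) (h _ _ (inj₁ refl))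
      (Fin2-repeat (block (f fz)) _ _ (blue (f fz) (f (fs fz)) (h _ _ tt)) (blue (f fz) (f (fs (fs fz))) (h _ _ tt))))
  where open Blocks 2 m M M≤

-- The rim of a blue wheel has odd length, yet it alternates between the two blocks that avoid the
-- hub: its first and last vertices, which are adjacent, would share a block.
three-cliques : ∀ j M → Arrows M (Wheel (8 + dbl j)) (Wheel (8 + dbl j)) → 3 * (8 + dbl j) ∸ 3 ≤ M
three-cliques j M arr with M ≤? 3 * (7 + dbl j)
... | no gt = ≤-trans (≤-reflexive (trans (cong (_∸ 3) (*-suc 3 (7 + dbl j))) (m+n∸m≡n 3 (3 * (7 + dbl j)))))
    (<⇒≤ (≰⇒> gt))
... | yes M≤ with arr (Blocks.colour 3 (7 + dbl j) M M≤) (Blocks.colour-sym 3 (7 + dbl j) M M≤)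
...   | inj₁ copy = ⊥-elim (Blocks.no-red 3 (7 + dbl j) M M≤ copy)
...   | inj₂ (f , _ , h) = ⊥-elim
    (blue (f (fs (fromℕ< last<))) (f (fs fz))
        (h (fs (fromℕ< last<)) (fs fz) (inj₂ (inj₂ (inj₂ (refl , cong suc (toℕ-fromℕ< last<))))))
          (returns (3 + j) last<))
  where
  open Blocks 3 (7 + dbl j) M M≤
  m = 7 + dbl j
  last< : 6 + dbl j < m
  last< = ≤-refl
  rim : ∀ i → i < m → Fin 3
  rim i lt = block (f (fs (fromℕ< lt)))
  rim≢hub : ∀ i lt → rim i lt ≢ block (f fz)
  rim≢hub i lt = blue (f (fs (fromℕ< lt))) (f fz) (h (fs (fromℕ< lt)) fz tt)
  step : ∀ i lt lt' → rim i lt ≢ rim (suc i) lt'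
  step i lt lt' = blue (f (fs (fromℕ< lt))) (f (fs (fromℕ< lt')))
      (h (fs (fromℕ< lt)) (fs (fromℕ< lt')) (inj₁ (trans (toℕ-fromℕ< lt') (cong suc (sym (toℕ-fromℕ< lt))))))
  returns : ∀ i lt → rim (dbl i) lt ≡ block (f (fs fz))
  returns zero lt = refl
  returns (suc i) lt = trans (sym
      (Fin3-return (block (f fz)) (rim (dbl i) lt₂) (rim (suc (dbl i)) lt₁) (rim (dbl (suc i)) lt)
      (rim≢hub _ lt₂) (rim≢hub _ lt₁) (rim≢hub _ lt) (step _ lt₂ lt₁) (step _ lt₁ lt))) (returns i lt₂)
    where
    lt₁ : suc (dbl i) < m
    lt₁ = <⇒≤ lt
    lt₂ : dbl i < m
    lt₂ = <⇒≤ lt₁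

-- Assembling the bounds

dbl%2 : ∀ i → dbl i % 2 ≡ 0
dbl%2 zero = refl
dbl%2 (suc i) = trans (trans (cong (_% 2) (+-comm 2 (dbl i))) ([m+kn]%n≡m%n (dbl i) 1 2)) (dbl%2 i)

suc-dbl%2 : ∀ i → suc (dbl i) % 2 ≡ 1
suc-dbl%2 zero = refl
suc-dbl%2 (suc i) = trans (trans (cong (_% 2) (+-comm 2 (suc (dbl i)))) ([m+kn]%n≡m%n (suc (dbl i)) 1 2)) (suc-dbl%2 i)

arrows-even : ∀ j → Arrows (8 * (8 + dbl j) ∸ 10) (Wheel (8 + dbl j)) (Wheel (8 + dbl j))
arrows-even j = subst (λ N → Arrows N (Wheel (8 + dbl j)) (Wheel (8 + dbl j))) eq
  (arrows (4 + dbl j) R (+-mono-≤ {7} {13} (m≤m+n 7 6)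
      (≤-trans (m≤m+n (dbl j) (dbl j)) (≤-reflexive (sym (dbl≡+ (dbl j))))))
    (λ col col-sym → Colour.odd-ramsey col col-sym j))
  where
  -- For rim length m = 7 + 2j this is 2m - 1, and 4R + 2 = 8(m + 1) - 10.
  R = 13 + dbl (dbl j)
  eq : 2 + ((R + R) + (R + R)) ≡ 8 * (8 + dbl j) ∸ 10
  eq = trans (cong (λ d → 2 + (((13 + d) + (13 + d)) + ((13 + d) + (13 + d)))) (dbl≡+ (dbl j)))
    (trans (sym (m+n∸m≡n 10 _)) (cong (_∸ 10)
        (solveℕ 1 (λ d → con 10 :+ (con 2 :+
            (((con 13 :+ (d :+ d)) :+ (con 13 :+ (d :+ d))) :+
                ((con 13 :+ (d :+ d)) :+ (con 13 :+ (d :+ d))))) := con 8 :* (con 8 :+ d)) refl (dbl j))))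

arrows-odd : ∀ j → Arrows (6 * (7 + dbl j) ∸ 8) (Wheel (7 + dbl j)) (Wheel (7 + dbl j))
arrows-odd j = subst (λ N → Arrows N (Wheel (7 + dbl j)) (Wheel (7 + dbl j))) eq
  (arrows (3 + dbl j) R (+-mono-≤ {6} {8} (m≤m+n 6 2) (m≤n+m (dbl j) j))
    (λ col col-sym → Colour.even-ramsey col col-sym j))
  where
  -- For rim length m = 6 + 2j this is 3m/2 - 1, and 4R + 2 = 6(m + 1) - 8.
  R = 8 + (j + dbl j)
  eq : 2 + ((R + R) + (R + R)) ≡ 6 * (7 + dbl j) ∸ 8
  eq = trans (cong (λ d → 2 + (((8 + (j + d)) + (8 + (j + d))) + ((8 + (j + d)) + (8 + (j + d))))) (dbl≡+ j))
    (trans (sym (m+n∸m≡n 8 _)) (cong (_∸ 8)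
        (trans (solveℕ 1 (λ j → con 8 :+
            (con 2 :+ (((con 8 :+ (j :+ (j :+ j))) :+ (con 8 :+ (j :+ (j :+ j)))) :+
                ((con 8 :+ (j :+ (j :+ j))) :+ (con 8 :+ (j :+ (j :+ j)))))) := con 6 :* (con 7 :+ (j :+ j))) refl j)
      (cong (λ d → 6 * (7 + d)) (sym (dbl≡+ j))))))

ramsey-number : ∀ n U → Arrows U (Wheel n) (Wheel n) → ∃ λ R → IsRamseyNumber (Wheel n) (Wheel n) R × R ≤ U
ramsey-number n U arr with R , arr' , low ← least (λ N → Arrows N (Wheel n) (Wheel n))
    (Arrows? (Wheel n) (Wheel-Adj? n)) U arr =
  R , (arr' , low) , low U arr

theorem6 : (n : ℕ) → 7 ≤ n →
    Σ ℕ λ R → IsRamseyNumber (Wheel n) (Wheel n) R ×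
    ((n % 2 ≡ 0 → (3 * n ∸ 3 ≤ R × R ≤ 8 * n ∸ 10))
    × (n % 2 ≡ 1 → (2 * n ∸ 2 ≤ R × R ≤ 6 * n ∸ 8)))
theorem6 n 7≤n with m≤n⇒∃[o]m+o≡n 7≤n
... | o , refl with even-or-odd o
...   | j , inj₁ refl = let R , number , upper = ramsey-number (7 + dbl j) (6 * (7 + dbl j) ∸ 8) (arrows-odd j) in
  R , number , (λ e → contradiction (trans (sym (suc-dbl%2 (3 + j))) e) λ ()) ,
  λ _ → two-cliques (7 + dbl j) (s≤s (s≤s (s≤s z≤n))) R (proj₁ number) , upper
...   | j , inj₂ refl = let R , number , upper = ramsey-number (8 + dbl j) (8 * (8 + dbl j) ∸ 10) (arrows-even j) in
  R , number , (λ _ → three-cliques j R (proj₁ number) , upper) ,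
  λ e → contradiction (trans (sym (dbl%2 (4 + j))) e) λ ()
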